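{- Let $d\ge1$ and $n\ge2$ be integers. Then \begin{align*} \sum_{\lambda\in\mathcal{C}_{n,dn-1}}|\lambda| &= M_d(n)\Bigl(\frac{(d^2-1)(5d^2+d-1)n^2}{24d(4d+1)}-\frac{(d+1)(8d^4+27d^3+2d^2-1)n}{24d(4d+1)^2}+\frac{d^2-1}{12d}\Bigr)\\ &\quad+M_d(n-1)\Bigl(\frac{(d+1)(-d^3+7d^2+d-1)n^2}{24d(4d+1)}-\frac{(d+1)(6d^4-19d^3-7d^2+d+1)n}{24d(4d+1)^2}\\ &\qquad\qquad-\frac{(d+1)(d^4+20d^3-6d^2-8d-1)}{12d(4d+1)^2}\Bigr). \end{align*}
   Context: A partition $\lambda=(\lambda_1\ge\dots\ge\lambda_\ell)$ has size $|\lambda|=\sum_i\lambda_i$. The hook length of a box of its Young diagram is the number of boxes directly to its right, directly below it, plus the box itself. For a positive integer $t$, $\lambda$ is a $t$-core if none of its hook lengths is divisible by $t$; an $(s,t)$-core is both an $s$-core and a $t$-core. $\mathcal{C}_{n,dn-1}$ is the set of $(n,dn-1)$-core partitions with distinct parts. The sequence $M_d(n)$ is defined by $M_d(-1)=0$, $M_d(0)=1$, $M_d(n)=M_d(n-1)+dM_d(n-2)$ for $n\ge1$. -}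

module Defs where

open import Data.Nat using (ℕ; zero; suc; _+_; _*_; _∸_; _<_; _<ᵇ_)
open import Data.Nat.Divisibility using (_∣_)
open import Data.Integer using (ℤ; +_) renaming (_+_ to _+ℤ_; _*_ to _*ℤ_; _-_ to _-ℤ_)
open import Data.Rational using (ℚ; _/_; 0ℚ) renaming (_+_ to _+ℚ_; _*_ to _*ℚ_; _-_ to _-ℚ_)
open import Data.List using (List; []; _∷_; length; lookup; drop; filterᵇ; map)
open import Data.Nat.ListAction using (sum)
open import Data.List.Relation.Unary.All using (All)
open import Data.List.Relation.Unary.Linked using (Linked)
open import Data.Fin using (Fin; toℕ)
open import Data.Product using (_×_)
open import Relation.Nullary using (¬_)

IsDistinctPartition : List ℕ → Set
IsDistinctPartition λs = Linked (λ a b → b < a) λs × All (λ a → 0 < a) λs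

size : List ℕ → ℕ
size = sum

-- hook length of the box in row i (0-indexed) and column j (0-indexed, j < λ_i):
-- arm (boxes to the right) + leg (boxes below) + 1
arm : (λs : List ℕ) → Fin (length λs) → ℕ → ℕ
arm λs i j = lookup λs i ∸ suc j

leg : (λs : List ℕ) → Fin (length λs) → ℕ → ℕ
leg λs i j = length (filterᵇ (λ a → j <ᵇ a) (drop (suc (toℕ i)) λs))

hook : (λs : List ℕ) → Fin (length λs) → ℕ → ℕ
hook λs i j = arm λs i j + leg λs i j + 1

IsCore : ℕ → List ℕ → Set
IsCore t λs = (i : Fin (length λs)) (j : ℕ) → j < lookup λs i → ¬ (t ∣ hook λs i j)

InC : ℕ → ℕ → List ℕ → Set
InC n d λs = IsDistinctPartition λs × IsCore n λs × IsCore (d * n ∸ 1) λs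

-- M_d(n) for n ≥ 0 (M_d(-1) = 0, so M_d(1) = M_d(0) + d·M_d(-1) = 1)
M : ℕ → ℕ → ℕ
M d zero = 1
M d (suc zero) = 1
M d (suc (suc n)) = M d (suc n) + d * M d n

-- rational a / b; only used with nonzero denominators (b = 0 mapped to 0 for totality)
_//_ : ℤ → ℕ → ℚ
a // zero = 0ℚ
a // suc b = a / suc b

{-# OPTIONS --safe #-}
-- A partition λ is determined by its beta-set S = {λ_i + #{k > i}}, and it is a t-core exactly when S is
-- closed under subtracting t (and avoids 0). Distinct parts mean that S contains no two consecutive
-- numbers. If S is closed under n and under dn - 1, an element x ≥ dn would put both x - dn and
-- x - dn + 1 into S, and x = dn - 1 would put 0 into S; so S lies below dn - 1, where closure under
-- dn - 1 is vacuous. Hence S = {r + kn : k < c_r} with c_0 = 0, c_r ≤ d, c_{n-1} ≤ d - 1 and no two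
-- adjacent nonzero c_r, and |λ| = Σ (r c_r + n C(c_r,2)) - C(Σ c_r,2). Removing the last column gives the
-- recursion of M_d for these words, so all sums over them are expressed through M_d and its second and
-- third convolution powers, and these are eliminated linearly.
module Submission where

open import Defs
open import Relation.Binary.PropositionalEquality

-- Let F = 1/(1 - x - dx²) be the generating series of M_d. Differentiating gives F' = (1 + 2dx) F²
-- and (F²)' = 2 (1 + 2dx) F³, and since (1 + 2dx)² + 4d (1 - x - dx²) = 4d + 1, the discriminant,
-- these relations can be inverted: (4d + 1) F² is a combination of F' and F, and (4d + 1) F³ one of
-- (F²)' and F². Taking coefficients yields four linear relations for the two convolutions at two
-- consecutive indices. Solving them costs a factor 4d + 1 at each level, hence the denominators (4d
-- + 1)², and a factor d for the values at the lower index. Natural numbers carry the counting, so a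
-- subtracted term is moved to the other side of its equation. Integers enter only for the
-- elimination, and rationals only for the final division.

-- From the totals over words to the closed formula.

module Formula where
  open import Data.Nat as ℕ using (ℕ; zero; suc; NonZero)
  import Data.Nat.Properties as ℕ
  import Data.Nat.Tactic.RingSolver as ℕ-Ring
  open import Data.Integer using (ℤ; +_; _+_; _*_; _-_; -_; _^_)
  open import Data.Integer.Properties as ℤ using (pos-*)
  open import Data.Integer.Tactic.RingSolver using (solve-∀; solve)
  open import Data.Rational using (fromℚᵘ) renaming (_+_ to _+ℚ_; _*_ to _*ℚ_; _-_ to _-ℚ_; -_ to -ℚ_)
  open import Data.Rational.Properties as ℚ using (fromℚᵘ-cong; fromℚᵘ-toℚᵘ; toℚᵘ-fromℚᵘ; toℚᵘ-homo-+; toℚᵘ-homo-*; toℚᵘ-homo‿-)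
  open import Data.Rational.Unnormalised as ℚᵘ using (mkℚᵘ; *≡*)
  import Data.Rational.Unnormalised.Properties as ℚᵘ
  open import Data.List using (_∷_; [])
  open import Data.Product using (∃; _,_)
  open ≡-Reasoning

  -- The factor 24, the constant of the denominator to be reached, lets `τ` and `σ` occur only as
  -- `2 * τ` and `6 * σ`, which are polynomials in d, and `W` only doubled, as it is known. In the
  -- application `s`, `T`, `W`, `G` are the totals of |λ|, C(Σ c_r,2), Σ r c_r and Σ C(c_r,2); `u`,
  -- `v` are the values of `conv₂` and `w`, `z` those of `conv₃` at n - 1 and n - 2; later `x`, `y`
  -- are M_d there. Unprimed `σ`, `τ` belong to the height bound d, primed ones to the bound e = d -
  -- 1 of the last column.
  size-equation : ∀ s T W G σ σ′ τ τ′ u v w z y e m → s ℕ.+ T ≡ W ℕ.+ (2 ℕ.+ m) ℕ.* G →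
    T ≡ (σ ℕ.* u ℕ.+ τ ℕ.* τ ℕ.* w) ℕ.+ (y ℕ.* σ′ ℕ.+ τ′ ℕ.* (τ ℕ.* v) ℕ.+ e ℕ.* (σ ℕ.* v ℕ.+ τ ℕ.* τ ℕ.* z)) →
    G ≡ σ ℕ.* u ℕ.+ (y ℕ.* σ′ ℕ.+ e ℕ.* (σ ℕ.* v)) →
    2 ℕ.* W ≡ τ ℕ.* ((1 ℕ.+ m) ℕ.* u) ℕ.+ (2 ℕ.* (y ℕ.* ((1 ℕ.+ m) ℕ.* τ′)) ℕ.+ e ℕ.* (τ ℕ.* (m ℕ.* v))) →
    24 ℕ.* s ℕ.+ (4 ℕ.* ((6 ℕ.* σ) ℕ.* u) ℕ.+ 6 ℕ.* ((2 ℕ.* τ) ℕ.* (2 ℕ.* τ) ℕ.* w) ℕ.+ 4 ℕ.* (y ℕ.* (6 ℕ.* σ′))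
        ℕ.+ 6 ℕ.* ((2 ℕ.* τ′) ℕ.* ((2 ℕ.* τ) ℕ.* v))
        ℕ.+ e ℕ.* (4 ℕ.* ((6 ℕ.* σ) ℕ.* v) ℕ.+ 6 ℕ.* ((2 ℕ.* τ) ℕ.* (2 ℕ.* τ) ℕ.* z)))
      ≡ 6 ℕ.* ((2 ℕ.* τ) ℕ.* ((1 ℕ.+ m) ℕ.* u)) ℕ.+ 12 ℕ.* (y ℕ.* ((1 ℕ.+ m) ℕ.* (2 ℕ.* τ′)))
          ℕ.+ 6 ℕ.* (e ℕ.* ((2 ℕ.* τ) ℕ.* (m ℕ.* v)))
          ℕ.+ (2 ℕ.+ m) ℕ.* (4 ℕ.* ((6 ℕ.* σ) ℕ.* u) ℕ.+ 4 ℕ.* (y ℕ.* (6 ℕ.* σ′))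
          ℕ.+ 4 ℕ.* (e ℕ.* ((6 ℕ.* σ) ℕ.* v)))
  size-equation s T W G σ σ′ τ τ′ u v w z y e m total≡ refl refl W≡ = begin
    _ ≡⟨ lemma₁ s σ σ′ τ τ′ u v w z y e ⟩
    24 ℕ.* (s ℕ.+ T) ≡⟨ cong (24 ℕ.*_) total≡ ⟩
    24 ℕ.* (W ℕ.+ (2 ℕ.+ m) ℕ.* G) ≡⟨ lemma₂ W m G ⟩
    12 ℕ.* (2 ℕ.* W) ℕ.+ 24 ℕ.* ((2 ℕ.+ m) ℕ.* G) ≡⟨ cong (λ k → 12 ℕ.* k ℕ.+ 24 ℕ.* ((2 ℕ.+ m) ℕ.* G)) W≡ ⟩
    _ ≡⟨ lemma₃ σ σ′ τ τ′ u v y e m ⟩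
    _ ∎
    where
    lemma₁ : ∀ s σ σ′ τ τ′ u v w z y e →
        24 ℕ.* s ℕ.+ (4 ℕ.* ((6 ℕ.* σ) ℕ.* u) ℕ.+ 6 ℕ.* ((2 ℕ.* τ) ℕ.* (2 ℕ.* τ) ℕ.* w) ℕ.+ 4 ℕ.* (y ℕ.* (6 ℕ.* σ′))
        ℕ.+ 6 ℕ.* ((2 ℕ.* τ′) ℕ.* ((2 ℕ.* τ) ℕ.* v))
        ℕ.+ e ℕ.* (4 ℕ.* ((6 ℕ.* σ) ℕ.* v) ℕ.+ 6 ℕ.* ((2 ℕ.* τ) ℕ.* (2 ℕ.* τ) ℕ.* z)))
      ≡ 24 ℕ.* (s ℕ.+ ((σ ℕ.* u ℕ.+ τ ℕ.* τ ℕ.* w)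
          ℕ.+ (y ℕ.* σ′ ℕ.+ τ′ ℕ.* (τ ℕ.* v) ℕ.+ e ℕ.* (σ ℕ.* v ℕ.+ τ ℕ.* τ ℕ.* z))))
    lemma₁ = ℕ-Ring.solve-∀
    lemma₂ : ∀ W m G → 24 ℕ.* (W ℕ.+ (2 ℕ.+ m) ℕ.* G) ≡ 12 ℕ.* (2 ℕ.* W) ℕ.+ 24 ℕ.* ((2 ℕ.+ m) ℕ.* G)
    lemma₂ = ℕ-Ring.solve-∀
    lemma₃ : ∀ σ σ′ τ τ′ u v y e m →
        12 ℕ.* (τ ℕ.* ((1 ℕ.+ m) ℕ.* u) ℕ.+ (2 ℕ.* (y ℕ.* ((1 ℕ.+ m) ℕ.* τ′)) ℕ.+ e ℕ.* (τ ℕ.* (m ℕ.* v))))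
        ℕ.+ 24 ℕ.* ((2 ℕ.+ m) ℕ.* (σ ℕ.* u ℕ.+ (y ℕ.* σ′ ℕ.+ e ℕ.* (σ ℕ.* v))))
      ≡ 6 ℕ.* ((2 ℕ.* τ) ℕ.* ((1 ℕ.+ m) ℕ.* u)) ℕ.+ 12 ℕ.* (y ℕ.* ((1 ℕ.+ m) ℕ.* (2 ℕ.* τ′)))
          ℕ.+ 6 ℕ.* (e ℕ.* ((2 ℕ.* τ) ℕ.* (m ℕ.* v)))
          ℕ.+ (2 ℕ.+ m) ℕ.* (4 ℕ.* ((6 ℕ.* σ) ℕ.* u) ℕ.+ 4 ℕ.* (y ℕ.* (6 ℕ.* σ′))
          ℕ.+ 4 ℕ.* (e ℕ.* ((6 ℕ.* σ) ℕ.* v)))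
    lemma₃ = ℕ-Ring.solve-∀

  -- A cast from ℕ to ℤ is written by mirroring the natural-number expression with ‵_, _⊕_ and _⊗_.
  infixl 6 _⊕_
  infixl 7 _⊗_

  ‵_ : ∀ a → + a ≡ + a
  ‵ a = refl

  _⊕_ : ∀ {a b a′ b′} → + a ≡ a′ → + b ≡ b′ → + (a ℕ.+ b) ≡ a′ + b′
  p ⊕ q = cong₂ _+_ p q

  _⊗_ : ∀ {a b a′ b′} → + a ≡ a′ → + b ≡ b′ → + (a ℕ.* b) ≡ a′ * b′
  _⊗_ {a} {b} p q = trans (pos-* a b) (cong₂ _*_ p q)

  transport : ∀ {a b a′ b′} → + a ≡ a′ → + b ≡ b′ → a ≡ b → a′ ≡ b′
  transport p q a≡b = trans (sym p) (trans (cong +_ a≡b) q)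

  -- The multipliers come from eliminating z, w, v, u in this order. The ring solver does not see through
  -- _-_ and _^_ on ℤ, hence the spelling.
  elimination-certificate : ∀ d m → ∃ λ c₀ → ∃ λ c₁ → ∃ λ c₂ → ∃ λ c₃ → ∃ λ c₄ → ∀ x y u v w z s →
    let q = + 4 * d + + 1; e = d + - (+ 1); n = + 2 + m
        n² = n * (n * + 1); d² = d * (d * + 1); d³ = d * d²; d⁴ = d * d³ in
    + 4 * (s * (+ 24 * d * (q * q)))
      ≡ + 4 * ((x + d * y) * ((d² + - (+ 1)) * (+ 5 * d² + d + - (+ 1)) * n² * q
          + - ((d + + 1) * (+ 8 * d⁴ + + 27 * d³ + + 2 * d² + - (+ 1)) * n) + (d² + - (+ 1)) * (+ 2 * (q * q)))
               + x * ((d + + 1) * (- d³ + + 7 * d² + d + - (+ 1)) * n² * q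
                   + - ((d + + 1) * (+ 6 * d⁴ + - (+ 19 * d³) + - (+ 7 * d²) + d + + 1) * n)
                   + - ((d + + 1) * (d⁴ + + 20 * d³ + - (+ 6 * d²) + - (+ 8 * d) + - (+ 1)) * + 2)))
      + (c₀ * (+ 24 * s + (+ 4 * ((+ 1 + d) * d * e * u) + + 6 * (d * (+ 1 + d) * (d * (+ 1 + d)) * w)
          + + 4 * (y * (d * e * (e + - (+ 1)))) + + 6 * (e * d * (d * (+ 1 + d) * v))
          + e * (+ 4 * ((+ 1 + d) * d * e * v) + + 6 * (d * (+ 1 + d) * (d * (+ 1 + d)) * z)))
               + - (+ 6 * (d * (+ 1 + d) * ((+ 1 + m) * u)) + + 12 * (y * ((+ 1 + m) * (e * d)))
                   + + 6 * (e * (d * (+ 1 + d) * (m * v)))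
                   + n * (+ 4 * ((+ 1 + d) * d * e * u) + + 4 * (y * (d * e * (e + - (+ 1))))
                   + + 4 * (e * ((+ 1 + d) * d * e * v)))))
      + c₁ * (u + + 2 * d * v + - (m * y))
      + c₂ * (q * u + n * y + - (+ 2 * ((+ 1 + m) * x)))
      + c₃ * (+ 2 * q * w + n * v + + 4 * u + - (+ 2 * ((+ 1 + m) * u)))
      + c₄ * (+ 2 * w + + 4 * d * z + + 2 * v + - (m * v)))
  elimination-certificate d m =
    let q = + 4 * d + + 1; e = d + - (+ 1); n = + 2 + m
        b = + 6 * (m * d * e * (d + + 1)) + + 4 * ((+ 1 + m) * d * e * e * (d + + 1))
            + - (+ 6 * (d * d * e * (d + + 1)))
        k = e * (d + + 1) * (d + + 1)
        b₁ = + 2 * q * b + - (+ 3 * (m + - (+ 2)) * q * d * k) + + 6 * n * d * d * (d + + 1) * (d + + 1)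
            + - (+ 3 * n * d * k)
        b₃ = + 6 * d * d * k + - (+ 12 * d * d * d * (d + + 1) * (d + + 1)) in
      + 4 * d * (q * q)
    , q * b₁
    , + 4 * d * q * (+ 6 * (d * (d + + 1) * (+ 1 + m)) + + 4 * ((+ 1 + m) * (d + + 1) * d * e)) + - b₁
        + + 2 * (m + - (+ 1)) * b₃
    , q * b₃
    , - (+ 6 * (q * q) * d * d * k)
    , λ x y u v w z s → solve (d ∷ m ∷ x ∷ y ∷ u ∷ v ∷ w ∷ z ∷ s ∷ [])

  cancel-vanishing : ∀ c₀ c₁ c₂ c₃ c₄ {t r a₀ b₀ a₁ b₁ a₂ b₂ a₃ b₃ a₄ b₄} → a₀ ≡ b₀ → a₁ ≡ b₁ → a₂ ≡ b₂ → a₃ ≡ b₃ →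
      a₄ ≡ b₄ →
    t ≡ r + (c₀ * (a₀ + - b₀) + c₁ * (a₁ + - b₁) + c₂ * (a₂ + - b₂) + c₃ * (a₃ + - b₃) + c₄ * (a₄ + - b₄)) → t ≡ r
  cancel-vanishing c₀ c₁ c₂ c₃ c₄ {r = r} {a₀} {_} {a₁} {_} {a₂} {_} {a₃} {_} {a₄} refl refl refl refl refl t≡ =
    trans t≡ (lemma c₀ c₁ c₂ c₃ c₄ r a₀ a₁ a₂ a₃ a₄)
    where
    lemma : ∀ c₀ c₁ c₂ c₃ c₄ r a₀ a₁ a₂ a₃ a₄ →
      r + (c₀ * (a₀ + - a₀) + c₁ * (a₁ + - a₁) + c₂ * (a₂ + - a₂) + c₃ * (a₃ + - a₃) + c₄ * (a₄ + - a₄)) ≡ r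
    lemma = solve-∀

  module _ (d n : ℤ) where
    private
      n² = n * (n * + 1); d² = d * (d * + 1); d³ = d * d²; d⁴ = d * d³

    -- Powers are written as `_^_` unfolds and differences as `_-_` unfolds, so the numerators in
    -- the theorem agree with these by `refl`.
    numerator₁ numerator₂ numerator₃ numerator₄ numerator₅ numerator₆ : ℤ
    numerator₁ = (d² + - (+ 1)) * (+ 5 * d² + d + - (+ 1)) * n²
    numerator₂ = (d + + 1) * (+ 8 * d⁴ + + 27 * d³ + + 2 * d² + - (+ 1)) * n
    numerator₃ = d² + - (+ 1)
    numerator₄ = (d + + 1) * (- d³ + + 7 * d² + d + - (+ 1)) * n²
    numerator₅ = (d + + 1) * (+ 6 * d⁴ + - (+ 19 * d³) + - (+ 7 * d²) + d + + 1) * n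
    numerator₆ = (d + + 1) * (d⁴ + + 20 * d³ + - (+ 6 * d²) + - (+ 8 * d) + - (+ 1))

  -- Everything that occurs under several products is a variable with a defining equation: comparing
  -- large products of integers up to conversion is infeasible.
  elimination : ∀ {d m q e n x x′ y u v w z s k₃ K n₁ n₂ n₃ n₄ n₅ n₆ : ℤ} →
    q ≡ + 4 * d + + 1 → e ≡ d + - (+ 1) → n ≡ + 2 + m → x′ ≡ x + d * y → k₃ ≡ + 2 * (q * q) → K ≡ + 24 * d * (q * q) →
    n₁ ≡ numerator₁ d n → n₂ ≡ numerator₂ d n → n₃ ≡ numerator₃ d n →
    n₄ ≡ numerator₄ d n → n₅ ≡ numerator₅ d n → n₆ ≡ numerator₆ d n →
    + 24 * s + (+ 4 * ((+ 1 + d) * d * e * u) + + 6 * (d * (+ 1 + d) * (d * (+ 1 + d)) * w)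
        + + 4 * (y * (d * e * (e + - (+ 1)))) + + 6 * (e * d * (d * (+ 1 + d) * v))
        + e * (+ 4 * ((+ 1 + d) * d * e * v) + + 6 * (d * (+ 1 + d) * (d * (+ 1 + d)) * z)))
      ≡ + 6 * (d * (+ 1 + d) * ((+ 1 + m) * u)) + + 12 * (y * ((+ 1 + m) * (e * d)))
          + + 6 * (e * (d * (+ 1 + d) * (m * v)))
          + n * (+ 4 * ((+ 1 + d) * d * e * u) + + 4 * (y * (d * e * (e + - (+ 1))))
          + + 4 * (e * ((+ 1 + d) * d * e * v))) →
    u + + 2 * d * v ≡ m * y → q * u + n * y ≡ + 2 * ((+ 1 + m) * x) →
    + 2 * q * w + n * v + + 4 * u ≡ + 2 * ((+ 1 + m) * u) → + 2 * w + + 4 * d * z + + 2 * v ≡ m * v →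
    s * K ≡ x′ * (n₁ * q + - n₂ + n₃ * k₃) + x * (n₄ * q + - n₅ + - (n₆ * + 2))
  elimination {d} {m} {x = x} {y = y} {u} {v} {w} {z}
      {s} refl refl refl refl refl refl refl refl refl refl refl refl h₀ h₁ h₂ h₃ h₄ =
    let c₀ , c₁ , c₂ , c₃ , c₄ , certificate = elimination-certificate d m in
    -- Without the factor 4, the multipliers of the two relations for `w` and `z` would have
    -- non-integer coefficients.
    ℤ.*-cancelˡ-≡ (+ 4) _ _ (cancel-vanishing c₀ c₁ c₂ c₃ c₄ h₀ h₁ h₂ h₃ h₄ (certificate x y u v w z s))

  integer-formula : ∀ {d e m x x′ y u v w z s a a′ b b′ : ℕ} → let q = 4 ℕ.* d ℕ.+ 1; n = 2 ℕ.+ m; D = + d; N = + n in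
    + e ≡ + d + - (+ 1) → + x′ ≡ + x + + d * + y →
    + a ≡ + d * (+ 1 + + d) → + a′ ≡ + e * + d → + b ≡ (+ 1 + + d) * + d * + e → + b′ ≡ + d * + e * (+ e + - (+ 1)) →
    24 ℕ.* s ℕ.+ (4 ℕ.* (b ℕ.* u) ℕ.+ 6 ℕ.* (a ℕ.* a ℕ.* w) ℕ.+ 4 ℕ.* (y ℕ.* b′) ℕ.+ 6 ℕ.* (a′ ℕ.* (a ℕ.* v))
        ℕ.+ e ℕ.* (4 ℕ.* (b ℕ.* v) ℕ.+ 6 ℕ.* (a ℕ.* a ℕ.* z)))
      ≡ 6 ℕ.* (a ℕ.* ((1 ℕ.+ m) ℕ.* u)) ℕ.+ 12 ℕ.* (y ℕ.* ((1 ℕ.+ m) ℕ.* a′)) ℕ.+ 6 ℕ.* (e ℕ.* (a ℕ.* (m ℕ.* v)))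
          ℕ.+ (2 ℕ.+ m) ℕ.* (4 ℕ.* (b ℕ.* u) ℕ.+ 4 ℕ.* (y ℕ.* b′) ℕ.+ 4 ℕ.* (e ℕ.* (b ℕ.* v))) →
    u ℕ.+ 2 ℕ.* d ℕ.* v ≡ m ℕ.* y → q ℕ.* u ℕ.+ n ℕ.* y ≡ 2 ℕ.* (suc m ℕ.* x) →
    2 ℕ.* q ℕ.* w ℕ.+ n ℕ.* v ℕ.+ 4 ℕ.* u ≡ 2 ℕ.* (suc m ℕ.* u) → 2 ℕ.* w ℕ.+ 4 ℕ.* d ℕ.* z ℕ.+ 2 ℕ.* v ≡ m ℕ.* v →
    + s * + (24 ℕ.* d ℕ.* (q ℕ.* q))
      ≡ + x′ * (numerator₁ D N * + q + - numerator₂ D N + numerator₃ D N * + (2 ℕ.* (q ℕ.* q)))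
        + + x * (numerator₄ D N * + q + - numerator₅ D N + - (numerator₆ D N * + 2))
  integer-formula {d} {e} {m} {x} {x′} {y} {u} {v} {w} {z} {s} e≡ x′≡ a≡ a′≡ b≡ b′≡ h₀ h₁ h₂ h₃ h₄ =
    elimination {+ d} {+ m} {+ q} {+ e} {+ n} {+ x} {+ x′} {+ y} {+ u} {+ v} {+ w} {+ z} {+ s}
      (‵ 4 ⊗ ‵ d ⊕ ‵ 1) e≡ refl x′≡ (‵ 2 ⊗ (‵ q ⊗ ‵ q)) (‵ 24 ⊗ ‵ d ⊗ (‵ q ⊗ ‵ q))
      refl refl refl refl refl refl
      (transport
        (‵ 24 ⊗ ‵ s ⊕ (‵ 4 ⊗ (b≡ ⊗ ‵ u) ⊕ ‵ 6 ⊗ (a≡ ⊗ a≡ ⊗ ‵ w) ⊕ ‵ 4 ⊗ (‵ y ⊗ b′≡) ⊕ ‵ 6 ⊗ (a′≡ ⊗ (a≡ ⊗ ‵ v))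
            ⊕ ‵ e ⊗ (‵ 4 ⊗ (b≡ ⊗ ‵ v) ⊕ ‵ 6 ⊗ (a≡ ⊗ a≡ ⊗ ‵ z))))
        (‵ 6 ⊗ (a≡ ⊗ ((‵ 1 ⊕ ‵ m) ⊗ ‵ u)) ⊕ ‵ 12 ⊗ (‵ y ⊗ ((‵ 1 ⊕ ‵ m) ⊗ a′≡)) ⊕ ‵ 6 ⊗ (‵ e ⊗ (a≡ ⊗ (‵ m ⊗ ‵ v)))
            ⊕ ‵ n ⊗ (‵ 4 ⊗ (b≡ ⊗ ‵ u) ⊕ ‵ 4 ⊗ (‵ y ⊗ b′≡) ⊕ ‵ 4 ⊗ (‵ e ⊗ (b≡ ⊗ ‵ v))))
        h₀)
      (transport (‵ u ⊕ ‵ 2 ⊗ ‵ d ⊗ ‵ v) (‵ m ⊗ ‵ y) h₁)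
      (transport (‵ q ⊗ ‵ u ⊕ ‵ n ⊗ ‵ y) (‵ 2 ⊗ ((‵ 1 ⊕ ‵ m) ⊗ ‵ x)) h₂)
      (transport (‵ 2 ⊗ ‵ q ⊗ ‵ w ⊕ ‵ n ⊗ ‵ v ⊕ ‵ 4 ⊗ ‵ u) (‵ 2 ⊗ ((‵ 1 ⊕ ‵ m) ⊗ ‵ u)) h₃)
      (transport (‵ 2 ⊗ ‵ w ⊕ ‵ 4 ⊗ ‵ d ⊗ ‵ z ⊕ ‵ 2 ⊗ ‵ v) (‵ m ⊗ ‵ v) h₄)
    where
    q = 4 ℕ.* d ℕ.+ 1
    n = 2 ℕ.+ m

  +triangle : ∀ t k → 2 ℕ.* t ≡ k ℕ.* suc k → + (2 ℕ.* t) ≡ + k * (+ 1 + + k)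
  +triangle t k = transport refl (‵ k ⊗ ‵ suc k)

  +tetra : ∀ t k → 6 ℕ.* t ℕ.+ k ℕ.* suc k ≡ suc k ℕ.* k ℕ.* k → + (6 ℕ.* t) ≡ (+ 1 + + k) * + k * (+ k + - (+ 1))
  +tetra t k eq = trans (lemma₁ (+ (6 ℕ.* t)) (+ k))
    (trans (cong (λ z → z + - (+ k * (+ 1 + + k)))
        (transport (‵ (6 ℕ.* t) ⊕ ‵ k ⊗ ‵ suc k) (‵ suc k ⊗ ‵ k ⊗ ‵ k) eq)) (lemma₂ (+ k)))
    where
    lemma₁ : ∀ t k → t ≡ t + k * (+ 1 + k) + - (k * (+ 1 + k))
    lemma₁ = solve-∀
    lemma₂ : ∀ k → (+ 1 + k) * k * k + - (k * (+ 1 + k)) ≡ (+ 1 + k) * k * (k + - (+ 1))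
    lemma₂ = solve-∀

  size-formula : ∀ s T W G σ σ′ τ τ′ u v w z x y e m →
    let d = suc e; q = 4 ℕ.* d ℕ.+ 1; n = 2 ℕ.+ m; D = + d; N = + n in
    2 ℕ.* τ ≡ d ℕ.* suc d → 2 ℕ.* τ′ ≡ e ℕ.* d →
    6 ℕ.* σ ℕ.+ d ℕ.* suc d ≡ suc d ℕ.* d ℕ.* d → 6 ℕ.* σ′ ℕ.+ e ℕ.* d ≡ d ℕ.* e ℕ.* e →
    s ℕ.+ T ≡ W ℕ.+ n ℕ.* G →
    T ≡ (σ ℕ.* u ℕ.+ τ ℕ.* τ ℕ.* w) ℕ.+ (y ℕ.* σ′ ℕ.+ τ′ ℕ.* (τ ℕ.* v) ℕ.+ e ℕ.* (σ ℕ.* v ℕ.+ τ ℕ.* τ ℕ.* z)) →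
    G ≡ σ ℕ.* u ℕ.+ (y ℕ.* σ′ ℕ.+ e ℕ.* (σ ℕ.* v)) →
    2 ℕ.* W ≡ τ ℕ.* ((1 ℕ.+ m) ℕ.* u) ℕ.+ (2 ℕ.* (y ℕ.* ((1 ℕ.+ m) ℕ.* τ′)) ℕ.+ e ℕ.* (τ ℕ.* (m ℕ.* v))) →
    u ℕ.+ 2 ℕ.* d ℕ.* v ≡ m ℕ.* y → q ℕ.* u ℕ.+ n ℕ.* y ≡ 2 ℕ.* (suc m ℕ.* x) →
    2 ℕ.* q ℕ.* w ℕ.+ n ℕ.* v ℕ.+ 4 ℕ.* u ≡ 2 ℕ.* (suc m ℕ.* u) → 2 ℕ.* w ℕ.+ 4 ℕ.* d ℕ.* z ℕ.+ 2 ℕ.* v ≡ m ℕ.* v →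
    + s * + (24 ℕ.* d ℕ.* (q ℕ.* q))
      ≡ + (x ℕ.+ d ℕ.* y) * (numerator₁ D N * + q + - numerator₂ D N + numerator₃ D N * + (2 ℕ.* (q ℕ.* q)))
        + + x * (numerator₄ D N * + q + - numerator₅ D N + - (numerator₆ D N * + 2))
  size-formula s T W G σ σ′ τ τ′ u v w z x y e m τ≡ τ′≡ σ≡ σ′≡ total≡ T≡ G≡ W≡ h₁ h₂ h₃ h₄ =
    integer-formula {suc e} {e} {m} {x} {x ℕ.+ suc e ℕ.* y} {y} {u} {v} {w} {z} {s} {2 ℕ.* τ} {2 ℕ.* τ′} {6 ℕ.* σ}
        {6 ℕ.* σ′}
      refl (‵ x ⊕ ‵ suc e ⊗ ‵ y) (+triangle τ (suc e) τ≡) (+triangle τ′ e τ′≡) (+tetra σ (suc e) σ≡) (+tetra σ′ e σ′≡)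
      (size-equation s T W G σ σ′ τ τ′ u v w z y e m total≡ T≡ G≡ W≡) h₁ h₂ h₃ h₄

  -- Fractions over a common denominator.

  -- `a / suc k` is `fromℚᵘ (mkℚᵘ a k)`. Once the operations commute with `fromℚᵘ`, an identity of
  -- fractions is a cross-multiplied identity of integers and no gcd appears.
  fromℚᵘ-+ : ∀ p q → fromℚᵘ p +ℚ fromℚᵘ q ≡ fromℚᵘ (p ℚᵘ.+ q)
  fromℚᵘ-+ p q = trans (sym (fromℚᵘ-toℚᵘ _)) (fromℚᵘ-cong
    (ℚᵘ.≃-trans (toℚᵘ-homo-+ (fromℚᵘ p) (fromℚᵘ q)) (ℚᵘ.+-cong (toℚᵘ-fromℚᵘ p) (toℚᵘ-fromℚᵘ q))))

  fromℚᵘ-* : ∀ p q → fromℚᵘ p *ℚ fromℚᵘ q ≡ fromℚᵘ (p ℚᵘ.* q)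
  fromℚᵘ-* p q = trans (sym (fromℚᵘ-toℚᵘ _)) (fromℚᵘ-cong
    (ℚᵘ.≃-trans (toℚᵘ-homo-* (fromℚᵘ p) (fromℚᵘ q)) (ℚᵘ.*-cong (toℚᵘ-fromℚᵘ p) (toℚᵘ-fromℚᵘ q))))

  fromℚᵘ-neg : ∀ p → -ℚ fromℚᵘ p ≡ fromℚᵘ (ℚᵘ.- p)
  fromℚᵘ-neg p = trans (sym (fromℚᵘ-toℚᵘ _)) (fromℚᵘ-cong
    (ℚᵘ.≃-trans (toℚᵘ-homo‿- (fromℚᵘ p)) (ℚᵘ.-‿cong (toℚᵘ-fromℚᵘ p))))

  //-+ : ∀ a b K → a // K +ℚ b // K ≡ (a + b) // K
  //-+ a b zero = refl
  //-+ a b (suc k) = trans (fromℚᵘ-+ (mkℚᵘ a k) (mkℚᵘ b k))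
      (fromℚᵘ-cong {mkℚᵘ a k ℚᵘ.+ mkℚᵘ b k} {mkℚᵘ (a + b) k} (*≡* (trans
    (lemma a b (+ suc k)) (cong ((a + b) *_) (sym (pos-* (suc k) (suc k)))))))
    where
    lemma : ∀ a b c → (a * c + b * c) * c ≡ (a + b) * (c * c)
    lemma = solve-∀

  //-neg : ∀ a K → -ℚ (a // K) ≡ (- a) // K
  //-neg a zero = refl
  //-neg a (suc k) = fromℚᵘ-neg (mkℚᵘ a k)

  //-- : ∀ a b K → a // K -ℚ b // K ≡ (a - b) // K
  //-- a b K = trans (cong (a // K +ℚ_) (//-neg b K)) (//-+ a (- b) K)

  //-* : ∀ a b K → (a // 1) *ℚ (b // K) ≡ (a * b) // K
  //-* a b zero = ℚ.*-zeroʳ (a // 1)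
  //-* a b (suc k) = trans (fromℚᵘ-* (mkℚᵘ a 0) (mkℚᵘ b k)) (fromℚᵘ-cong {mkℚᵘ a 0 ℚᵘ.* mkℚᵘ b k} {mkℚᵘ (a * b) k}
    (*≡* (cong (λ z → a * b * (+ suc z)) (sym (ℕ.+-identityʳ k)))))

  //-scale : ∀ a b c .{{_ : NonZero b}} .{{_ : NonZero c}} → a // b ≡ (a * + c) // (b ℕ.* c)
  //-scale a (suc b) (suc c) = fromℚᵘ-cong {mkℚᵘ a b} {mkℚᵘ (a * + suc c) (c ℕ.+ b ℕ.* suc c)}
      (*≡* (trans (cong (a *_) (pos-* (suc b) (suc c))) (lemma a (+ suc b) (+ suc c))))
    where
    lemma : ∀ a b c → a * (b * c) ≡ a * c * b
    lemma = solve-∀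

  //-rescale : ∀ a {b c K} .{{_ : NonZero b}} .{{_ : NonZero c}} → b ℕ.* c ≡ K → a // b ≡ (a * + c) // K
  //-rescale a {b} {c} refl = //-scale a b c

  -- `K` is the common denominator and `k₁`, `k₃`, `k₆` are the cofactors that lift the smaller
  -- denominators to it. Each numerator is given twice, as it occurs in the integer identity and as
  -- it occurs in the theorem.
  //-combine : ∀ s x y {n₁ n₂ n₃ n₄ n₅ n₆} p₁ p₂ p₃ p₄ p₅ p₆ b₁ b₃ b₆ k₁ k₃ k₆ K .{{_ : NonZero b₁}} .{{_ : NonZero b₃}} .{{_ : NonZero b₆}} .{{_ : NonZero K}}
    .{{_ : NonZero k₁}} .{{_ : NonZero k₃}} .{{_ : NonZero k₆}} →
    n₁ ≡ p₁ → n₂ ≡ p₂ → n₃ ≡ p₃ → n₄ ≡ p₄ → n₅ ≡ p₅ → n₆ ≡ p₆ →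
    b₁ ℕ.* k₁ ≡ K → b₃ ℕ.* k₃ ≡ K → b₆ ℕ.* k₆ ≡ K →
    s * + K ≡ x * (n₁ * + k₁ + - n₂ + n₃ * + k₃) + y * (n₄ * + k₁ + - n₅ + - (n₆ * + k₆)) →
    s // 1 ≡ (x // 1) *ℚ ((p₁ // b₁) -ℚ (p₂ // K) +ℚ (p₃ // b₃))
        +ℚ (y // 1) *ℚ ((p₄ // b₁) -ℚ (p₅ // K) -ℚ (p₆ // b₆))
  //-combine s x y n₁ n₂ n₃ n₄ n₅ n₆ b₁ b₃ b₆ k₁ k₃ k₆ K refl refl refl refl refl refl e₁ e₃ e₆ eq = begin
    s // 1 ≡⟨ //-rescale s {1} {K} (ℕ.*-identityˡ K) ⟩
    (s * + K) // K ≡⟨ cong (_// K) eq ⟩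
    (x * (n₁ * + k₁ + - n₂ + n₃ * + k₃) + y * (n₄ * + k₁ + - n₅ + - (n₆ * + k₆))) // K
      ≡⟨ sym (//-+ _ _ K) ⟩
    _ ≡⟨ sym (cong₂ _+ℚ_ (//-* x _ K) (//-* y _ K)) ⟩
    _ ≡⟨ sym (cong₂ (λ a b → (x // 1) *ℚ a +ℚ (y // 1) *ℚ b)
           (trans (cong₂ _+ℚ_ (trans (cong (_-ℚ n₂ // K) (//-rescale n₁ e₁)) (//-- _ _ K)) (//-rescale n₃ e₃))
               (//-+ _ _ K))
           (trans (cong₂ _-ℚ_ (trans (cong (_-ℚ n₅ // K) (//-rescale n₄ e₁)) (//-- _ _ K)) (//-rescale n₆ e₆))
               (//-- _ _ K))) ⟩
    _ ∎

  rational-formula : ∀ (s x y : ℤ) (d n : ℕ) .{{_ : NonZero d}} → let q = 4 ℕ.* d ℕ.+ 1; D = + d; N = + n in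
    s * + (24 ℕ.* d ℕ.* (q ℕ.* q))
      ≡ x * (numerator₁ D N * + q + - numerator₂ D N + numerator₃ D N * + (2 ℕ.* (q ℕ.* q)))
        + y * (numerator₄ D N * + q + - numerator₅ D N + - (numerator₆ D N * + 2)) →
    s // 1
      ≡ (x // 1) *ℚ
          ((((D ^ 2 - + 1) * (+ 5 * D ^ 2 + D - + 1) * N ^ 2) // (24 ℕ.* d ℕ.* q))
           -ℚ (((D + + 1) * (+ 8 * D ^ 4 + + 27 * D ^ 3 + + 2 * D ^ 2 - + 1) * N) // (24 ℕ.* d ℕ.* (q ℕ.* q)))
           +ℚ ((D ^ 2 - + 1) // (12 ℕ.* d)))
        +ℚ (y // 1) *ℚ
          ((((D + + 1) * (- (D ^ 3) + + 7 * D ^ 2 + D - + 1) * N ^ 2) // (24 ℕ.* d ℕ.* q))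
           -ℚ (((D + + 1) * (+ 6 * D ^ 4 - + 19 * D ^ 3 - + 7 * D ^ 2 + D + + 1) * N) // (24 ℕ.* d ℕ.* (q ℕ.* q)))
           -ℚ (((D + + 1) * (D ^ 4 + + 20 * D ^ 3 - + 6 * D ^ 2 - + 8 * D - + 1)) // (12 ℕ.* d ℕ.* (q ℕ.* q))))
  rational-formula s x y d n =
    let q = 4 ℕ.* d ℕ.+ 1; D = + d; N = + n in
    //-combine s x y
    ((D ^ 2 - + 1) * (+ 5 * D ^ 2 + D - + 1) * N ^ 2)
    ((D + + 1) * (+ 8 * D ^ 4 + + 27 * D ^ 3 + + 2 * D ^ 2 - + 1) * N)
    (D ^ 2 - + 1)
    ((D + + 1) * (- (D ^ 3) + + 7 * D ^ 2 + D - + 1) * N ^ 2)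
    ((D + + 1) * (+ 6 * D ^ 4 - + 19 * D ^ 3 - + 7 * D ^ 2 + D + + 1) * N)
    ((D + + 1) * (D ^ 4 + + 20 * D ^ 3 - + 6 * D ^ 2 - + 8 * D - + 1))
    (24 ℕ.* d ℕ.* q) (12 ℕ.* d) (12 ℕ.* d ℕ.* (q ℕ.* q)) q (2 ℕ.* (q ℕ.* q)) 2 (24 ℕ.* d ℕ.* (q ℕ.* q))
    refl refl refl refl refl refl (ℕ.*-assoc (24 ℕ.* d) q q) (lemma₃ d (q ℕ.* q)) (lemma₆ d (q ℕ.* q))
    where
    q = 4 ℕ.* d ℕ.+ 1
    instance
      q≢0 : NonZero q
      q≢0 = ℕ.>-nonZero (ℕ.m≤n+m 1 (4 ℕ.* d))
      q*q≢0 : NonZero (q ℕ.* q)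
      q*q≢0 = ℕ.m*n≢0 q q
      2*q*q≢0 : NonZero (2 ℕ.* (q ℕ.* q))
      2*q*q≢0 = ℕ.m*n≢0 2 (q ℕ.* q)
      12*d≢0 : NonZero (12 ℕ.* d)
      12*d≢0 = ℕ.m*n≢0 12 d
      24*d≢0 : NonZero (24 ℕ.* d)
      24*d≢0 = ℕ.m*n≢0 24 d
      24*d*q≢0 : NonZero (24 ℕ.* d ℕ.* q)
      24*d*q≢0 = ℕ.m*n≢0 (24 ℕ.* d) q
      24*d*q*q≢0 : NonZero (24 ℕ.* d ℕ.* (q ℕ.* q))
      24*d*q*q≢0 = ℕ.m*n≢0 (24 ℕ.* d) (q ℕ.* q)
      12*d*q*q≢0 : NonZero (12 ℕ.* d ℕ.* (q ℕ.* q))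
      12*d*q*q≢0 = ℕ.m*n≢0 (12 ℕ.* d) (q ℕ.* q)
    lemma₃ : ∀ d r → 12 ℕ.* d ℕ.* (2 ℕ.* r) ≡ 24 ℕ.* d ℕ.* r
    lemma₃ = ℕ-Ring.solve-∀
    lemma₆ : ∀ d r → 12 ℕ.* d ℕ.* r ℕ.* 2 ≡ 24 ℕ.* d ℕ.* r
    lemma₆ = ℕ-Ring.solve-∀

open import Data.Nat
open import Data.Nat.Properties
open import Data.Nat.DivMod
open import Data.Nat.Divisibility using (_∣_; divides; ∣⇒≤; n∣m*n; ∣-refl)
open import Data.Nat.ListAction using (sum)
open import Data.Nat.ListAction.Properties using (sum-++)
open import Data.Nat.Tactic.RingSolver using (solve-∀)
open import Data.Bool using (Bool; true; false; T; if_then_else_)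
open import Data.Unit using (tt)
open import Data.Fin using (zero; suc)
open import Data.Product hiding (map)
open import Data.Sum using (_⊎_; inj₁; inj₂)
open import Data.List using (List; []; _∷_; map; length; _++_; filterᵇ; downFrom; cartesianProductWith)
open import Data.List.Properties using (map-++; map-∘; map-cong; length-++; length-map; length-filter; ∷-injectiveʳ)
open import Data.List.Membership.Propositional using (_∈_; _∉_)
open import Data.List.Membership.Propositional.Properties
  using (∈-++⁺ˡ; ∈-++⁺ʳ; ∈-map⁺; ∈-map⁻; ∈-cartesianProductWith⁺; ∈-cartesianProductWith⁻; ∈-downFrom⁺)
open import Data.List.Membership.DecPropositional _≟_ using (_∈?_)
open import Data.List.Relation.Unary.Any using (here; there)
open import Data.List.Relation.Unary.All as All using (All; []; _∷_)
open import Data.List.Relation.Unary.All.Properties using (++⁺; map⁺)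
open import Data.List.Relation.Unary.AllPairs using (AllPairs; []; _∷_)
open import Data.List.Relation.Unary.Linked.Properties using (Linked⇒AllPairs; AllPairs⇒Linked)
open import Data.List.Relation.Unary.Unique.Propositional using (Unique)
import Data.List.Relation.Unary.Unique.Propositional.Properties as Unique
open import Function using (_∘_; _⇔_; mk⇔)
open import Relation.Nullary
open import Relation.Nullary.Decidable using (⌊_⌋; toWitness; fromWitness)
open import Relation.Binary.Definitions using (tri<; tri≈; tri>)
open ≡-Reasoning

-- Sums over abacus words

-- The binomial coefficient C(k,2), not C(k + 1,2).
tri : ℕ → ℕ
tri zero = 0
tri (suc k) = k + tri k

tri-+ : ∀ a b → tri (a + b) ≡ tri a + tri b + a * b
tri-+ zero b = sym (+-identityʳ _)
tri-+ (suc a) b rewrite tri-+ a b = lemma a b (tri a) (tri b)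
  where
  lemma : ∀ a b s t → a + b + (s + t + a * b) ≡ a + s + t + (b + a * b)
  lemma = solve-∀

prepend : ℕ → List ℕ → List ℕ
prepend v s = suc v ∷ 0 ∷ s

extend : ℕ → List (List ℕ) → List (List ℕ) → List (List ℕ)
extend e L L′ = map (0 ∷_) L ++ cartesianProductWith prepend (downFrom e) L′

-- A word lists column heights c_{m-1}, …, c_0 of an abacus, highest residue first, with c_0 = 0,
-- c_r ≤ d and no two adjacent nonzero entries; coreWords d m has m + 2 columns and c_{m+1} ≤ d - 1.
words : ℕ → ℕ → List (List ℕ)
words d 0 = [] ∷ []
words d 1 = (0 ∷ []) ∷ []
words d (suc (suc m)) = extend d (words d (suc m)) (words d m)

coreWords : ℕ → ℕ → List (List ℕ)
coreWords d m = extend (pred d) (words d (suc m)) (words d m)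

-- The entry `v` stands in column `length s`, so this is Σ r c_r.
weighted : List ℕ → ℕ
weighted [] = 0
weighted (v ∷ s) = length s * v + weighted s

triSum : List ℕ → ℕ
triSum s = sum (map tri s)

total : (List ℕ → ℕ) → List (List ℕ) → ℕ
total f L = sum (map f L)

sumBelow : (ℕ → ℕ) → ℕ → ℕ
sumBelow a e = sum (map a (downFrom e))

total-++ : ∀ f L L′ → total f (L ++ L′) ≡ total f L + total f L′
total-++ f L L′ rewrite map-++ f L L′ = sum-++ (map f L) (map f L′)

total-map : ∀ f g L → total f (map g L) ≡ total (f ∘ g) L
total-map f g L = cong sum (sym (map-∘ L))

total-affine : ∀ (f g h : List ℕ → ℕ) a b L → All (λ s → f s ≡ a + b * h s + g s) L →
  total f L ≡ length L * a + b * total h L + total g L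
total-affine f g h a b [] [] rewrite *-zeroʳ b = refl
total-affine f g h a b (s ∷ L) (e ∷ es) rewrite e | total-affine f g h a b L es =
  lemma a b (h s) (g s) (length L) (total h L) (total g L)
  where
  lemma : ∀ a b x y l X Y → a + b * x + y + (l * a + b * X + Y) ≡ a + l * a + b * (x + X) + (y + Y)
  lemma = solve-∀

total-prepend : ∀ (f g h : List ℕ → ℕ) (a b : ℕ → ℕ) L →
  (∀ v → All (λ s → f (prepend v s) ≡ a v + b v * h s + g s) L) → ∀ e →
  total f (cartesianProductWith prepend (downFrom e) L)
    ≡ length L * sumBelow a e + sumBelow b e * total h L + e * total g L
total-prepend f g h a b L eq zero = sym (trans (+-identityʳ _) (trans (+-identityʳ _) (*-zeroʳ (length L))))
total-prepend f g h a b L eq (suc e) = begin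
  total f (map (prepend e) L ++ rest)
    ≡⟨ total-++ f (map (prepend e) L) rest ⟩
  total f (map (prepend e) L) + total f rest
    ≡⟨ cong₂ _+_ (trans (total-map f (prepend e) L) (total-affine _ g h (a e) (b e) L (eq e)))
        (total-prepend f g h a b L eq e) ⟩
  (length L * a e + b e * total h L + total g L)
      + (length L * sumBelow a e + sumBelow b e * total h L + e * total g L)
    ≡⟨ lemma (length L) (a e) (b e) (total h L) (total g L) (sumBelow a e) (sumBelow b e) e ⟩
  length L * (a e + sumBelow a e) + (b e + sumBelow b e) * total h L + suc e * total g L ∎
  where
  rest = cartesianProductWith prepend (downFrom e) L
  lemma : ∀ l x y H G A B e → (l * x + y * H + G) + (l * A + B * H + e * G) ≡ l * (x + A) + (y + B) * H + (G + e * G)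
  lemma = solve-∀


length-prepend : ∀ e L → length (cartesianProductWith prepend (downFrom e) L) ≡ e * length L
length-prepend zero L = refl
length-prepend (suc e) L = trans (length-++ (map (prepend e) L))
  (cong₂ _+_ (length-map (prepend e) L) (length-prepend e L))

length-words : ∀ d m → length (words d m) ≡ M d m
length-words d zero = refl
length-words d (suc zero) = refl
length-words d (suc (suc m)) = trans (length-++ (map (0 ∷_) (words d (suc m))))
  (cong₂ _+_ (trans (length-map (0 ∷_) (words d (suc m))) (length-words d (suc m)))
             (trans (length-prepend d (words d m)) (cong (d *_) (length-words d m))))

All-extend : ∀ {P Q R : List ℕ → Set} e {L L′} → (∀ {s} → P s → R (0 ∷ s)) →
  (∀ {v s} → v < e → Q s → R (prepend v s)) → All P L → All Q L′ → All R (extend e L L′)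
All-extend {Q = Q} {R} e {L} {L′} p q ps qs = ++⁺ (map⁺ (All.map p ps)) (go e q)
  where
  go : ∀ e → (∀ {v s} → v < e → Q s → R (prepend v s)) → All R (cartesianProductWith prepend (downFrom e) L′)
  go zero q = []
  go (suc e) q = ++⁺ (map⁺ (All.map (q ≤-refl) qs)) (go e λ v<e → q (m<n⇒m<1+n v<e))

All-words : ∀ (P : ℕ → List ℕ → Set) d → P 0 [] → P 1 (0 ∷ []) → (∀ {m s} → P (suc m) s → P (2 + m) (0 ∷ s)) →
  (∀ {m v s} → v < d → P m s → P (2 + m) (prepend v s)) → ∀ m → All (P m) (words d m)
All-words P d p₀ p₁ p q zero = p₀ ∷ []
All-words P d p₀ p₁ p q (suc zero) = p₁ ∷ []
All-words P d p₀ p₁ p q (suc (suc m)) =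
  All-extend d p q (All-words P d p₀ p₁ p q (suc m)) (All-words P d p₀ p₁ p q m)

words-length : ∀ d m → All (λ s → length s ≡ m) (words d m)
words-length d = All-words (λ m s → length s ≡ m) d refl refl (cong suc) (λ _ → cong (2 +_))

-- A new top block changes every statistic by a term in the new height alone, except C(Σ c_r,2):
-- there the cross term of `tri-+` multiplies the new height by the old sum, which is what `b` and
-- `h` are for.
total-extend : ∀ (f h : List ℕ → ℕ) (a b : ℕ → ℕ) e L L′ → (∀ s → f (0 ∷ s) ≡ f s) →
  (∀ v → All (λ s → f (prepend v s) ≡ a v + b v * h s + f s) L′) →
  total f (extend e L L′) ≡ total f L + (length L′ * sumBelow a e + sumBelow b e * total h L′ + e * total f L′)
total-extend f h a b e L L′ f₀ f₊ = begin
  total f (extend e L L′)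
    ≡⟨ total-++ f (map (0 ∷_) L) _ ⟩
  total f (map (0 ∷_) L) + total f (cartesianProductWith prepend (downFrom e) L′)
    ≡⟨ cong₂ _+_ (trans (total-map f (0 ∷_) L) (cong sum (map-cong f₀ L))) (total-prepend f f h a b L′ f₊ e) ⟩
  total f L + (length L′ * sumBelow a e + sumBelow b e * total h L′ + e * total f L′) ∎

sumBelow-* : ∀ c a e → sumBelow (λ v → c * a v) e ≡ c * sumBelow a e
sumBelow-* c a zero = sym (*-zeroʳ c)
sumBelow-* c a (suc e) rewrite sumBelow-* c a e = sym (*-distribˡ-+ c (a e) (sumBelow a e))

total-extend′ : ∀ (f : List ℕ → ℕ) (a : ℕ → ℕ) e L L′ → (∀ s → f (0 ∷ s) ≡ f s) →
  (∀ v → All (λ s → f (prepend v s) ≡ a v + f s) L′) →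
  total f (extend e L L′) ≡ total f L + (length L′ * sumBelow a e + e * total f L′)
total-extend′ f a e L L′ f₀ f₊ =
  trans (total-extend f (λ _ → 0) a (λ _ → 0) e L L′ f₀ (λ v →
      All.map (λ eq → trans eq (cong (_+ _) (sym (+-identityʳ (a v))))) (f₊ v)))
        (cong (λ z → total f L + (z + e * total f L′))
            (trans (cong (λ z → length L′ * sumBelow a e + z * total (λ _ → 0) L′) (sumBelow-* 0 (λ _ → 0) e))
            (+-identityʳ _)))

-- C(k + 1,2) and C(k + 1,3), as the sums of c and of C(c,2) over the nonzero heights c = 1, ..., k
-- of a column.
triangle tetra : ℕ → ℕ
triangle = sumBelow suc
tetra = sumBelow (tri ∘ suc)

-- Convolution powers of the sequence M_d.

-- With generating functions x²/(1 - x - dx²)² and x⁴/(1 - x - dx²)³.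
conv₂ conv₃ : ℕ → ℕ → ℕ
conv₂ d zero = 0
conv₂ d (suc zero) = 0
conv₂ d (suc (suc m)) = conv₂ d (suc m) + d * conv₂ d m + M d m
conv₃ d zero = 0
conv₃ d (suc zero) = 0
conv₃ d (suc (suc m)) = conv₃ d (suc m) + d * conv₃ d m + conv₂ d m

-- The coefficients of x F' = x (1 + 2dx) F², where F = 1/(1 - x - dx²) and `conv₂` has the series
-- x² F².
conv₂-M : ∀ d m → conv₂ d (suc m) + 2 * d * conv₂ d m ≡ m * M d m
conv₂-M d zero = *-zeroʳ (2 * d)
conv₂-M d (suc zero) = lemma d
  where
  lemma : ∀ d → 0 + d * 0 + 1 + 2 * d * 0 ≡ 1 * 1
  lemma = solve-∀
conv₂-M d (suc (suc m)) = begin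
  conv₂ d (3 + m) + 2 * d * conv₂ d (2 + m)
    ≡⟨ lemma₁ d (conv₂ d (2 + m)) (conv₂ d (suc m)) (conv₂ d m) (M d (suc m)) (M d m) ⟩
  (conv₂ d (2 + m) + 2 * d * conv₂ d (suc m)) + d * (conv₂ d (suc m) + 2 * d * conv₂ d m) + M d (suc m)
      + 2 * d * M d m
    ≡⟨ cong₂ (λ a b → a + d * b + M d (suc m) + 2 * d * M d m) (conv₂-M d (suc m)) (conv₂-M d m) ⟩
  suc m * M d (suc m) + d * (m * M d m) + M d (suc m) + 2 * d * M d m
    ≡⟨ lemma₂ d m (M d (suc m)) (M d m) ⟩
  (2 + m) * M d (2 + m) ∎
  where
  lemma₁ : ∀ d u″ u′ u x y → (u″ + d * u′ + x) + 2 * d * (u′ + d * u + y)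
      ≡ (u″ + 2 * d * u′) + d * (u′ + 2 * d * u) + x + 2 * d * y
  lemma₁ = solve-∀
  lemma₂ : ∀ d m x y → (1 + m) * x + d * (m * y) + x + 2 * d * y ≡ (2 + m) * (x + d * y)
  lemma₂ = solve-∀

-- The coefficients of x U' = 2U + 2x³ (1 + 2dx) F³ for U = x² F², the series of `conv₂`.
conv₃-conv₂ : ∀ d m → 2 * conv₃ d (suc m) + 4 * d * conv₃ d m + 2 * conv₂ d m ≡ m * conv₂ d m
conv₃-conv₂ d zero = lemma d
  where
  lemma : ∀ d → 2 * 0 + 4 * d * 0 + 2 * 0 ≡ 0 * 0
  lemma = solve-∀
conv₃-conv₂ d (suc zero) = lemma d
  where
  lemma : ∀ d → 2 * (0 + d * 0 + 0) + 4 * d * 0 + 2 * 0 ≡ 1 * 0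
  lemma = solve-∀
conv₃-conv₂ d (suc (suc m)) = begin
  2 * conv₃ d (3 + m) + 4 * d * conv₃ d (2 + m) + 2 * conv₂ d (2 + m)
    ≡⟨ lemma₁ d (conv₃ d (2 + m)) (conv₃ d (suc m)) (conv₃ d m) (conv₂ d (suc m)) (conv₂ d m) (M d m) ⟩
  (2 * conv₃ d (2 + m) + 4 * d * conv₃ d (suc m) + 2 * conv₂ d (suc m))
      + d * (2 * conv₃ d (suc m) + 4 * d * conv₃ d m + 2 * conv₂ d m)
    + 2 * (conv₂ d (suc m) + 2 * d * conv₂ d m) + 2 * M d m
    ≡⟨ cong₂ (λ a b → a + d * b + 2 * (conv₂ d (suc m) + 2 * d * conv₂ d m) + 2 * M d m) (conv₃-conv₂ d (suc m))
        (conv₃-conv₂ d m) ⟩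
  suc m * conv₂ d (suc m) + d * (m * conv₂ d m) + 2 * (conv₂ d (suc m) + 2 * d * conv₂ d m) + 2 * M d m
    ≡⟨ lemma₂ d m (conv₂ d (suc m)) (conv₂ d m) (M d m) ⟩
  suc m * conv₂ d (suc m) + d * (m * conv₂ d m) + (conv₂ d (suc m) + 2 * d * conv₂ d m) + 2 * M d m
      + (conv₂ d (suc m) + 2 * d * conv₂ d m)
    ≡⟨ cong (λ z → suc m * conv₂ d (suc m) + d * (m * conv₂ d m) + (conv₂ d (suc m) + 2 * d * conv₂ d m) + 2 * M d m
        + z) (conv₂-M d m) ⟩
  suc m * conv₂ d (suc m) + d * (m * conv₂ d m) + (conv₂ d (suc m) + 2 * d * conv₂ d m) + 2 * M d m + m * M d m
    ≡⟨ lemma₃ d m (conv₂ d (suc m)) (conv₂ d m) (M d m) ⟩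
  (2 + m) * conv₂ d (2 + m) ∎
  where
  lemma₁ : ∀ d w″ w′ w u′ u y → 2 * (w″ + d * w′ + u′) + 4 * d * (w′ + d * w + u) + 2 * (u′ + d * u + y)
    ≡ (2 * w″ + 4 * d * w′ + 2 * u′) + d * (2 * w′ + 4 * d * w + 2 * u) + 2 * (u′ + 2 * d * u) + 2 * y
  lemma₁ = solve-∀
  lemma₂ : ∀ d m u′ u y → (1 + m) * u′ + d * (m * u) + 2 * (u′ + 2 * d * u) + 2 * y
    ≡ (1 + m) * u′ + d * (m * u) + (u′ + 2 * d * u) + 2 * y + (u′ + 2 * d * u)
  lemma₂ = solve-∀
  lemma₃ : ∀ d m u′ u y → (1 + m) * u′ + d * (m * u) + (u′ + 2 * d * u) + 2 * y + m * y ≡ (2 + m) * (u′ + d * u + y)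
  lemma₃ = solve-∀

-- Eliminates `conv₂ d m` from the relation `conv₂-M` at `m` and at `suc m`; on series this is
-- multiplication of F' by 1 + 2dx, which leaves the constant 4d + 1 in front of F².
conv₂-closed : ∀ d m → (4 * d + 1) * conv₂ d (suc m) + (2 + m) * M d m ≡ 2 * (suc m * M d (suc m))
conv₂-closed d m = begin
  (4 * d + 1) * conv₂ d (suc m) + (2 + m) * M d m
    ≡⟨ lemma₁ d m (conv₂ d (suc m)) (M d m) ⟩
  (4 * d + 1) * conv₂ d (suc m) + 2 * M d m + m * M d m
    ≡⟨ cong ((4 * d + 1) * conv₂ d (suc m) + 2 * M d m +_) (conv₂-M d m) ⟨
  (4 * d + 1) * conv₂ d (suc m) + 2 * M d m + (conv₂ d (suc m) + 2 * d * conv₂ d m)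
    ≡⟨ lemma₂ d (conv₂ d (suc m)) (conv₂ d m) (M d m) ⟩
  2 * (conv₂ d (2 + m) + 2 * d * conv₂ d (suc m))
    ≡⟨ cong (2 *_) (conv₂-M d (suc m)) ⟩
  2 * (suc m * M d (suc m)) ∎
  where
  lemma₁ : ∀ d m u y → (4 * d + 1) * u + (2 + m) * y ≡ (4 * d + 1) * u + 2 * y + m * y
  lemma₁ = solve-∀
  lemma₂ : ∀ d u′ u y → (4 * d + 1) * u′ + 2 * y + (u′ + 2 * d * u) ≡ 2 * (u′ + d * u + y + 2 * d * u′)
  lemma₂ = solve-∀

-- The same elimination one level higher, between `conv₃-conv₂` at `m` and at `suc m`.
conv₃-closed : ∀ d m → 2 * (4 * d + 1) * conv₃ d (suc m) + (2 + m) * conv₂ d m + 4 * conv₂ d (suc m)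
    ≡ 2 * (suc m * conv₂ d (suc m))
conv₃-closed d m = begin
  2 * (4 * d + 1) * conv₃ d (suc m) + (2 + m) * conv₂ d m + 4 * conv₂ d (suc m)
    ≡⟨ lemma₁ d m (conv₃ d (suc m)) (conv₂ d (suc m)) (conv₂ d m) ⟩
  2 * (4 * d + 1) * conv₃ d (suc m) + 2 * conv₂ d m + 4 * conv₂ d (suc m) + m * conv₂ d m
    ≡⟨ cong (2 * (4 * d + 1) * conv₃ d (suc m) + 2 * conv₂ d m + 4 * conv₂ d (suc m) +_) (conv₃-conv₂ d m) ⟨
  2 * (4 * d + 1) * conv₃ d (suc m) + 2 * conv₂ d m + 4 * conv₂ d (suc m)
      + (2 * conv₃ d (suc m) + 4 * d * conv₃ d m + 2 * conv₂ d m)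
    ≡⟨ lemma₂ d (conv₃ d (suc m)) (conv₃ d m) (conv₂ d (suc m)) (conv₂ d m) ⟩
  2 * (2 * conv₃ d (2 + m) + 4 * d * conv₃ d (suc m) + 2 * conv₂ d (suc m))
    ≡⟨ cong (2 *_) (conv₃-conv₂ d (suc m)) ⟩
  2 * (suc m * conv₂ d (suc m)) ∎
  where
  lemma₁ : ∀ d m w u′ u → 2 * (4 * d + 1) * w + (2 + m) * u + 4 * u′ ≡ 2 * (4 * d + 1) * w + 2 * u + 4 * u′ + m * u
  lemma₁ = solve-∀
  lemma₂ : ∀ d w′ w u′ u → 2 * (4 * d + 1) * w′ + 2 * u + 4 * u′ + (2 * w′ + 4 * d * w + 2 * u)
      ≡ 2 * (2 * (w′ + d * w + u) + 4 * d * w′ + 2 * u′)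
  lemma₂ = solve-∀

-- Totals of the four statistics over the words.

sum-extend : ∀ d e m → total sum (extend e (words d (suc m)) (words d m))
  ≡ total sum (words d (suc m)) + (M d m * triangle e + e * total sum (words d m))
sum-extend d e m = trans (total-extend′ sum suc e (words d (suc m)) (words d m) (λ _ → refl) (λ _ →
    All.universal (λ _ → refl) (words d m)))
  (cong (λ l → total sum (words d (suc m)) + (l * triangle e + e * total sum (words d m))) (length-words d m))

triSum-extend : ∀ d e m → total triSum (extend e (words d (suc m)) (words d m))
  ≡ total triSum (words d (suc m)) + (M d m * tetra e + e * total triSum (words d m))
triSum-extend d e m = trans
    (total-extend′ triSum (tri ∘ suc) e (words d (suc m)) (words d m) (λ _ → refl) (λ _ →
    All.universal (λ _ → refl) (words d m)))
  (cong (λ l → total triSum (words d (suc m)) + (l * tetra e + e * total triSum (words d m))) (length-words d m))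

weighted-extend : ∀ d e m → total weighted (extend e (words d (suc m)) (words d m))
  ≡ total weighted (words d (suc m)) + (M d m * (suc m * triangle e) + e * total weighted (words d m))
weighted-extend d e m = trans
  (total-extend′ weighted (λ v → suc m * suc v) e (words d (suc m)) (words d m) (λ s →
      cong (_+ weighted s) (*-zeroʳ (length s))) (λ v → All.map (λ {s} → step v {s}) (words-length d m)))
  (cong₂ (λ l t → total weighted (words d (suc m)) + (l * t + e * total weighted (words d m))) (length-words d m)
      (sumBelow-* (suc m) suc e))
  where
  step : ∀ v {s} → length s ≡ m → weighted (prepend v s) ≡ suc m * suc v + weighted s
  step v {s} refl = cong (suc m * suc v +_) (cong (_+ weighted s) (*-zeroʳ m))

triOfSum-extend : ∀ d e m → total (tri ∘ sum) (extend e (words d (suc m)) (words d m))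
  ≡ total (tri ∘ sum) (words d (suc m))
      + (M d m * tetra e + triangle e * total sum (words d m) + e * total (tri ∘ sum) (words d m))
triOfSum-extend d e m = trans
  (total-extend (tri ∘ sum) sum (tri ∘ suc) suc e (words d (suc m)) (words d m) (λ _ → refl) (λ v →
      All.universal (step v) (words d m)))
  (cong (λ l → total (tri ∘ sum) (words d (suc m))
      + (l * tetra e + triangle e * total sum (words d m) + e * total (tri ∘ sum) (words d m))) (length-words d m))
  where
  step : ∀ v s → tri (suc v + sum s) ≡ tri (suc v) + suc v * sum s + tri (sum s)
  step v s = trans (tri-+ (suc v) (sum s)) (lemma (tri (suc v)) (tri (sum s)) (suc v * sum s))
    where
    lemma : ∀ a b c → a + b + c ≡ a + c + b
    lemma = solve-∀

total-sum : ∀ d m → total sum (words d m) ≡ triangle d * conv₂ d m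
total-sum d zero = sym (*-zeroʳ (triangle d))
total-sum d (suc zero) = sym (*-zeroʳ (triangle d))
total-sum d (suc (suc m)) = trans (sum-extend d d m)
  (trans (cong₂ (λ a b → a + (M d m * triangle d + d * b)) (total-sum d (suc m)) (total-sum d m))
    (lemma d (triangle d) (conv₂ d (suc m)) (conv₂ d m) (M d m)))
  where
  lemma : ∀ d t u′ u y → t * u′ + (y * t + d * (t * u)) ≡ t * (u′ + d * u + y)
  lemma = solve-∀

total-triSum : ∀ d m → total triSum (words d m) ≡ tetra d * conv₂ d m
total-triSum d zero = sym (*-zeroʳ (tetra d))
total-triSum d (suc zero) = sym (*-zeroʳ (tetra d))
total-triSum d (suc (suc m)) = trans (triSum-extend d d m)
  (trans (cong₂ (λ a b → a + (M d m * tetra d + d * b)) (total-triSum d (suc m)) (total-triSum d m))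
    (lemma d (tetra d) (conv₂ d (suc m)) (conv₂ d m) (M d m)))
  where
  lemma : ∀ d t u′ u y → t * u′ + (y * t + d * (t * u)) ≡ t * (u′ + d * u + y)
  lemma = solve-∀

-- Reversing the columns 1, ..., m - 1 permutes the words and sends column r to m - r, so the mean
-- position is m/2 and the total is m/2 times the total of the sums. The recursion proves this
-- without the bijection.
total-weighted : ∀ d m → 2 * total weighted (words d m) ≡ triangle d * (m * conv₂ d m)
total-weighted d zero = sym (*-zeroʳ (triangle d))
total-weighted d (suc zero) = sym (*-zeroʳ (triangle d))
total-weighted d (suc (suc m)) = begin
  2 * total weighted (words d (2 + m))
    ≡⟨ cong (2 *_) (weighted-extend d d m) ⟩
  2 * (w′ + (y * (suc m * t) + d * w))
    ≡⟨ lemma₁ d m t y w′ w ⟩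
  2 * w′ + d * (2 * w) + t * (2 * y + m * y + m * y)
    ≡⟨ cong₂ (λ a b → a + d * b + t * (2 * y + m * y + m * y)) (total-weighted d (suc m)) (total-weighted d m) ⟩
  t * (suc m * u′) + d * (t * (m * u)) + t * (2 * y + m * y + m * y)
    -- Only one of the two copies of `m * y` is converted: it supplies the missing `u′ + 2 * d * u`,
    -- while the other belongs to `(2 + m) * y`.
    ≡⟨ cong (λ z → t * (suc m * u′) + d * (t * (m * u)) + t * (2 * y + z + m * y)) (conv₂-M d m) ⟨
  t * (suc m * u′) + d * (t * (m * u)) + t * (2 * y + (u′ + 2 * d * u) + m * y)
    ≡⟨ lemma₂ d m t y u′ u ⟩
  t * ((2 + m) * conv₂ d (2 + m)) ∎
  where
  t = triangle d
  y = M d m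
  u′ = conv₂ d (suc m)
  u = conv₂ d m
  w′ = total weighted (words d (suc m))
  w = total weighted (words d m)
  lemma₁ : ∀ d m t y w′ w →
      2 * (w′ + (y * ((1 + m) * t) + d * w)) ≡ 2 * w′ + d * (2 * w) + t * (2 * y + m * y + m * y)
  lemma₁ = solve-∀
  lemma₂ : ∀ d m t y u′ u →
      t * ((1 + m) * u′) + d * (t * (m * u)) + t * (2 * y + (u′ + 2 * d * u) + m * y)
      ≡ t * ((2 + m) * (u′ + d * u + y))
  lemma₂ = solve-∀

-- C(Σ c_r,2) is Σ C(c_r,2) plus the products of the heights of two different columns. A word is a
-- sequence of single empty columns and of nonzero columns, each with the empty one below it.
-- Marking one nonzero column leaves two free words, which gives `conv₂`; marking two leaves three,
-- which gives `conv₃`.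
total-triOfSum : ∀ d m → total (tri ∘ sum) (words d m) ≡ tetra d * conv₂ d m + triangle d * triangle d * conv₃ d m
total-triOfSum d zero = sym (cong₂ _+_ (*-zeroʳ (tetra d)) (*-zeroʳ (triangle d * triangle d)))
total-triOfSum d (suc zero) = sym (cong₂ _+_ (*-zeroʳ (tetra d)) (*-zeroʳ (triangle d * triangle d)))
total-triOfSum d (suc (suc m)) = begin
  total (tri ∘ sum) (words d (2 + m))
    ≡⟨ triOfSum-extend d d m ⟩
  total (tri ∘ sum) (words d (suc m))
      + (M d m * tetra d + triangle d * total sum (words d m) + d * total (tri ∘ sum) (words d m))
    ≡⟨ cong₂ (λ a b → a + (M d m * tetra d + triangle d * total sum (words d m) + d * b)) (total-triOfSum d (suc m))
        (total-triOfSum d m) ⟩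
  _ ≡⟨ cong (λ z → tetra d * conv₂ d (suc m) + triangle d * triangle d * conv₃ d (suc m)
      + (M d m * tetra d + triangle d * z + d * (tetra d * conv₂ d m + triangle d * triangle d * conv₃ d m)))
      (total-sum d m) ⟩
  _ ≡⟨ lemma d (tetra d) (triangle d) (conv₃ d (suc m)) (conv₃ d m) (conv₂ d (suc m)) (conv₂ d m) (M d m) ⟩
  tetra d * conv₂ d (2 + m) + triangle d * triangle d * conv₃ d (2 + m) ∎
  where
  lemma : ∀ d s t w′ w u′ u y → s * u′ + t * t * w′ + (y * s + t * (t * u) + d * (s * u + t * t * w))
    ≡ s * (u′ + d * u + y) + t * t * (w′ + d * w + u)
  lemma = solve-∀

triangle-tri : ∀ k → triangle k ≡ tri (suc k)
triangle-tri zero = refl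
triangle-tri (suc k) = cong (suc k +_) (triangle-tri k)

2*triangle : ∀ k → 2 * triangle k ≡ k * suc k
2*triangle zero = refl
2*triangle (suc k) = trans (*-distribˡ-+ 2 (suc k) (triangle k))
    (trans (cong (2 * suc k +_) (2*triangle k)) (lemma k))
  where
  lemma : ∀ k → 2 * (1 + k) + k * (1 + k) ≡ (1 + k) * (2 + k)
  lemma = solve-∀

6*tetra : ∀ k → 6 * tetra k + k * suc k ≡ suc k * k * k
6*tetra zero = refl
6*tetra (suc k) = begin
  6 * (tri (suc k) + tetra k) + suc k * (2 + k)
    ≡⟨ cong (λ t → 6 * (t + tetra k) + suc k * (2 + k)) (sym (triangle-tri k)) ⟩
  6 * (triangle k + tetra k) + suc k * (2 + k)
    ≡⟨ lemma₁ k (triangle k) (tetra k) ⟩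
  3 * (2 * triangle k) + (6 * tetra k + k * suc k) + 2 * suc k
    ≡⟨ cong₂ (λ a b → 3 * a + b + 2 * suc k) (2*triangle k) (6*tetra k) ⟩
  3 * (k * suc k) + suc k * k * k + 2 * suc k
    ≡⟨ lemma₂ k ⟩
  (2 + k) * suc k * suc k ∎
  where
  lemma₁ : ∀ k a b → 6 * (a + b) + (1 + k) * (2 + k) ≡ 3 * (2 * a) + (6 * b + k * (1 + k)) + 2 * (1 + k)
  lemma₁ = solve-∀
  lemma₂ : ∀ k → 3 * (k * (1 + k)) + (1 + k) * k * k + 2 * (1 + k) ≡ (2 + k) * (1 + k) * (1 + k)
  lemma₂ = solve-∀

-- Hook lengths and beta-sets

beta : List ℕ → List ℕ
beta [] = []
beta (a ∷ λs) = a + length λs ∷ beta λs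

Decreasing : List ℕ → Set
Decreasing = AllPairs _>_

-- From one row to the next both the part and the number of rows below drop, so beta elements differ
-- by at least 2. This is where distinctness of the parts enters.
beta-bound : ∀ {a λs} → All (a >_) λs → ∀ {x} → x ∈ beta λs → suc x < a + length λs
beta-bound {a} {b ∷ λs} (b<a ∷ _) (here refl) rewrite +-suc a (length λs) = s≤s (+-monoˡ-< (length λs) b<a)
beta-bound {a} {b ∷ λs} (_ ∷ r) (there x∈) rewrite +-suc a (length λs) = <-trans (beta-bound r x∈) (n<1+n _)

<ᵇ-true : ∀ {k c} → k < c → (k <ᵇ c) ≡ true
<ᵇ-true {k} {c} k<c with k <ᵇ c | <⇒<ᵇ k<c
... | true | _ = refl

<ᵇ-false : ∀ {k c} → c ≤ k → (k <ᵇ c) ≡ false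
<ᵇ-false {k} {c} c≤k with k <ᵇ c | <ᵇ⇒< k c
... | true | k<c = contradiction (k<c tt) (≤⇒≯ c≤k)
... | false | _ = refl

longer : List ℕ → ℕ → ℕ
longer λs j = length (filterᵇ (j <ᵇ_) λs)

longer-keep : ∀ {j a} λs → j < a → longer (a ∷ λs) j ≡ suc (longer λs j)
longer-keep λs j<a rewrite <ᵇ-true j<a = refl

longer-drop : ∀ {j a} λs → a ≤ j → longer (a ∷ λs) j ≡ longer λs j
longer-drop λs a≤j rewrite <ᵇ-false a≤j = refl

longer-none : ∀ {j λs} → All (j ≥_) λs → longer λs j ≡ 0
longer-none [] = refl
longer-none {λs = _ ∷ λs} (a≤j ∷ r) = trans (longer-drop λs a≤j) (longer-none r)

longer≤length : ∀ λs j → longer λs j ≤ length λs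
longer≤length λs j = length-filter _ λs

-- The map j ↦ j + #{k : λ_k ≤ j} enumerates the complement of the beta-set.
gap-exists : ∀ {λs} → Decreasing λs → ∀ {v} → v ∉ beta λs → ∃ λ j → v + longer λs j ≡ j + length λs
gap-exists [] {v} _ = v , refl
gap-exists {b ∷ λs} (b> ∷ dec) {v} v∉ with <-cmp v (b + length λs)
... | tri≈ _ refl _ = contradiction (here refl) v∉
... | tri< v< _ _ with gap-exists dec (v∉ ∘ there)
...   | j , eq with j <? b
...     | yes j<b = j , trans (cong (v +_) (longer-keep λs j<b))
    (trans (+-suc v _) (trans (cong suc eq) (sym (+-suc j _))))
...     | no j≮b = contradiction v< (≤⇒≯ (≤-trans (+-monoˡ-≤ (length λs) (≮⇒≥ j≮b)) (≤-reflexive (sym v≡))))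
  where
  v≡ : v ≡ j + length λs
  v≡ = trans (sym (+-identityʳ v))
      (trans (cong (v +_) (sym (longer-none (All.map (λ c<b → ≤-trans (<⇒≤ c<b) (≮⇒≥ j≮b)) b>)))) eq)
gap-exists {b ∷ λs} (b> ∷ dec) {v} v∉ | tri> _ _ v> = j ,
  trans (cong (v +_) (longer-none {j} (b≤j ∷ All.map (λ c<b → ≤-trans (<⇒≤ c<b) b≤j) b>)))
    (trans (+-identityʳ v) (sym (m∸n+n≡m (≤-trans (s≤s (m≤n+m _ b)) v>))))
  where
  -- Above the top element no row is longer than `j`, so all `suc (length λs)` rows have been
  -- passed.
  j = v ∸ suc (length λs)
  b≤j : b ≤ j
  b≤j = m+n≤o⇒m≤o∸n b (subst (_≤ v) (sym (+-suc b _)) v>)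

gap-avoids : ∀ {λs} → Decreasing λs → ∀ {v} j → v + longer λs j ≡ j + length λs → v ∉ beta λs
gap-avoids {b ∷ λs} (b> ∷ dec) {v} j eq v∈ with j <? b
... | yes j<b = go v∈
  where
  eq′ : v + longer λs j ≡ j + length λs
  eq′ = suc-injective (trans (sym (+-suc v _))
      (trans (cong (v +_) (sym (longer-keep λs j<b))) (trans eq (+-suc j _))))
  go : v ∉ beta (b ∷ λs)
  go (there v∈′) = gap-avoids dec j eq′ v∈′
  go (here refl) = <⇒≱ (+-monoˡ-< (length λs) j<b) (≤-trans (m≤m+n _ _) (≤-reflexive eq′))
... | no j≮b = go v∈
  where
  b≤j = ≮⇒≥ j≮b
  v≡ : v ≡ suc (j + length λs)
  v≡ = trans (sym (+-identityʳ v))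
      (trans (cong (v +_) (sym (longer-none (b≤j ∷ All.map (λ c<b → ≤-trans (<⇒≤ c<b) b≤j) b>))))
      (trans eq (+-suc j _)))
  bound : v ∈ beta (b ∷ λs) → v ≤ b + length λs
  bound (here refl) = ≤-refl
  bound (there x) = <⇒≤ (<-trans (n<1+n _) (beta-bound b> x))
  go : v ∉ beta (b ∷ λs)
  go v∈ = <⇒≱ (s≤s (+-monoˡ-≤ (length λs) b≤j)) (subst (_≤ b + length λs) v≡ (bound v∈))

-- Cores and closed beta-sets.

-- All positive multiples of `t` are subtracted at once, because `IsCore` forbids every hook length
-- divisible by `t`. The case `h ≡ x` is included: as 0 is no beta element of a partition, it
-- excludes the multiples of `t` themselves.
Closed : ℕ → List ℕ → Set
Closed t B = ∀ {x} h → x ∈ B → 0 < h → t ∣ h → h ≤ x → x ∸ h ∈ B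

hook-+ : ∀ {a j} c → j < a → (a ∸ suc j + c + 1) + j ≡ a + c
hook-+ {a} {j} c j<a = trans (lemma (a ∸ suc j) c j) (cong (_+ c) (m∸n+n≡m j<a))
  where
  lemma : ∀ x c j → (x + c + 1) + j ≡ x + suc j + c
  lemma = solve-∀

hook-gap : ∀ {a j λs} (v : ℕ) h → h + v ≡ a + length λs → h + j ≡ a + longer λs j → v + longer λs j ≡ j + length λs
hook-gap {a} {j} {λs} v h top hook≡ = +-cancelˡ-≡ (h + a) _ _ (trans (lemma₁ h a v _)
  (trans (cong₂ _+_ top (sym hook≡)) (lemma₂ a (length λs) h j)))
  where
  lemma₁ : ∀ h a v c → h + a + (v + c) ≡ (h + v) + (a + c)
  lemma₁ = solve-∀
  lemma₂ : ∀ a l h j → (a + l) + (h + j) ≡ h + a + (j + l)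
  lemma₂ = solve-∀

-- The hooks of the first row are the differences between the top beta element and the gaps below
-- it. If the top minus `h` were a gap, its column would carry a hook of length `h`. The other rows
-- are those of the tail.
core⇒closed : ∀ {t λs} → Decreasing λs → IsCore t λs → Closed t (beta λs)
core⇒closed {t} {a ∷ λs} (a> ∷ dec) core h (there x∈) 0<h t∣h h≤x =
  there (core⇒closed dec (λ i → core (suc i)) h x∈ 0<h t∣h h≤x)
core⇒closed {t} {a ∷ λs} (a> ∷ dec) core h (here refl) 0<h t∣h h≤x with (a + length λs ∸ h) ∈? beta λs
... | yes v∈ = there v∈
... | no v∉ with gap-exists dec v∉
...   | j , eq with j <? a
...     | yes j<a = contradiction (subst (t ∣_) (sym hook≡h) t∣h) (core zero j j<a)
  where
  v = a + length λs ∸ h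
  rearrange : h + j ≡ a + longer λs j
  rearrange = +-cancelʳ-≡ (length λs) _ _ (trans (+-assoc h j _) (trans (cong (h +_) (sym eq))
    (trans (sym (+-assoc h v _))
        (trans (cong (_+ longer λs j) (m+[n∸m]≡n h≤x)) (lemma a (length λs) (longer λs j))))))
    where
    lemma : ∀ a l c → a + l + c ≡ a + c + l
    lemma = solve-∀
  hook≡h : a ∸ suc j + longer λs j + 1 ≡ h
  hook≡h = +-cancelʳ-≡ j _ _ (trans (hook-+ (longer λs j) j<a) (sym rearrange))
...     | no j≮a = contradiction v<top (≤⇒≯ (≤-trans (+-monoˡ-≤ (length λs) a≤j) (≤-reflexive (sym v≡))))
  where
  a≤j = ≮⇒≥ j≮a
  v = a + length λs ∸ h
  v<top : v < a + length λs
  v<top = ∸-monoʳ-< 0<h h≤x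
  v≡ : v ≡ j + length λs
  v≡ = trans (sym (+-identityʳ v))
      (trans (cong (v +_) (sym (longer-none (All.map (λ c<a → ≤-trans (<⇒≤ c<a) a≤j) a>)))) eq)

beta-tail : ∀ {a λs} → All (a >_) λs → ∀ {x y} → x ≤ y → y < a + length λs → x ∈ beta (a ∷ λs) → x ∈ beta λs
beta-tail _ x≤y y< (here refl) = contradiction (≤-<-trans x≤y y<) (<-irrefl refl)
beta-tail _ _ _ (there x∈) = x∈

-- The same correspondence read backwards. Closure is inherited by the tail, since subtracting from
-- a tail element never yields the larger top element.
closed⇒core : ∀ {t λs} → Decreasing λs → Closed t (beta λs) → IsCore t λs
closed⇒core {t} {a ∷ λs} (a> ∷ dec) closed (suc i) = closed⇒core dec closed′ i
  where
  closed′ : Closed t (beta λs)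
  closed′ {x} h x∈ 0<h t∣h h≤x =
    beta-tail a> (m∸n≤m x h) (<-trans (n<1+n _) (beta-bound a> x∈)) (closed h (there x∈) 0<h t∣h h≤x)
closed⇒core {t} {a ∷ λs} (a> ∷ dec) closed zero j j<a t∣hook =
  gap-avoids dec j (hook-gap {a} {j} {λs} v h (m+[n∸m]≡n h≤top) hook≡)
    (beta-tail a> ≤-refl (∸-monoʳ-< 0<h h≤top) (closed h (here refl) 0<h t∣hook h≤top))
  where
  h = hook (a ∷ λs) zero j
  hook≡ : h + j ≡ a + longer λs j
  hook≡ = hook-+ (longer λs j) j<a
  v = a + length λs ∸ h
  0<h : 0 < h
  0<h = m≤n+m 1 (a ∸ suc j + longer λs j)
  h≤top : h ≤ a + length λs
  h≤top = ≤-trans (m≤m+n h j) (≤-trans (≤-reflexive hook≡) (+-monoʳ-≤ a (longer≤length λs j)))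

-- From a set of numbers back to a partition.

-- The partition whose beta-set consists of the x < N with p x.
encode : (ℕ → Bool) → ℕ → List ℕ
encode p zero = []
encode p (suc N) = if p N then N ∸ length (encode p N) ∷ encode p N else encode p N

encode-length≤ : ∀ p N → length (encode p N) ≤ N
encode-length≤ p zero = z≤n
encode-length≤ p (suc N) with p N
... | true = s≤s (encode-length≤ p N)
... | false = m≤n⇒m≤1+n (encode-length≤ p N)

∈-encode⁻ : ∀ p N {x} → x ∈ beta (encode p N) → x < N × T (p x)
∈-encode⁻ p (suc N) x∈ with p N in eq
∈-encode⁻ p (suc N) x∈ | false = map₁ m<n⇒m<1+n (∈-encode⁻ p N x∈)
∈-encode⁻ p (suc N) (there x∈) | true = map₁ m<n⇒m<1+n (∈-encode⁻ p N x∈)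
∈-encode⁻ p (suc N) (here refl) | true rewrite m∸n+n≡m (encode-length≤ p N) = ≤-refl , subst T (sym eq) tt

∈-encode⁺ : ∀ p N {x} → x < N → T (p x) → x ∈ beta (encode p N)
∈-encode⁺ p (suc N) {x} x<N px with x ≟ N | p N in eq
... | yes refl | true = here (sym (m∸n+n≡m (encode-length≤ p N)))
... | yes refl | false = contradiction (subst T eq px) λ ()
... | no x≢N | true = there (∈-encode⁺ p N (≤∧≢⇒< (s≤s⁻¹ x<N) x≢N) px)
... | no x≢N | false = ∈-encode⁺ p N (≤∧≢⇒< (s≤s⁻¹ x<N) x≢N) px

encode-bounds : ∀ p N → All (λ a → a + length (encode p N) ≤ N) (encode p N)
encode-bounds p zero = []
encode-bounds p (suc N) with p N
... | false = All.map m≤n⇒m≤1+n (encode-bounds p N)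
... | true = ≤-reflexive (trans (+-suc _ _) (cong suc (m∸n+n≡m (encode-length≤ p N))))
  ∷ All.map (λ {a} le → subst (_≤ suc N) (sym (+-suc a _)) (s≤s le)) (encode-bounds p N)

module _ (p : ℕ → Bool) (p0 : ¬ T (p 0)) (sparse : ∀ x → T (p x) → ¬ T (p (suc x))) where

  -- The predecessor of a bead is not a bead, so the parts already encoded use only smaller
  -- positions; that spare position makes the new part positive and strictly larger than the others.
  encode-head : ∀ N → T (p N) → 0 < N ∸ length (encode p N) × All (N ∸ length (encode p N) >_) (encode p N)
  encode-head zero pN = contradiction pN p0
  encode-head (suc N) pN with p N in eq
  ... | true = contradiction pN (sparse N (subst T (sym eq) tt))
  ... | false = m<n⇒0<n∸m (s≤s (encode-length≤ p N))
    , All.map (λ {a} le → m+n≤o⇒m≤o∸n (suc a) (s≤s le)) (encode-bounds p N)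

  encode-decreasing : ∀ N → Decreasing (encode p N)
  encode-decreasing zero = []
  encode-decreasing (suc N) with p N in eq
  ... | true = proj₂ (encode-head N (subst T (sym eq) tt)) ∷ encode-decreasing N
  ... | false = encode-decreasing N

  encode-positive : ∀ N → All (0 <_) (encode p N)
  encode-positive zero = []
  encode-positive (suc N) with p N in eq
  ... | true = proj₁ (encode-head N (subst T (sym eq) tt)) ∷ encode-positive N
  ... | false = encode-positive N

encode-unique : ∀ p N {λs} → Decreasing λs → (∀ {x} → x ∈ beta λs → x < N × T (p x)) →
  (∀ {x} → x < N → T (p x) → x ∈ beta λs) → λs ≡ encode p N
encode-unique p zero {[]} _ _ _ = refl
encode-unique p zero {a ∷ λs} _ f _ = contradiction (proj₁ (f (here refl))) λ ()
encode-unique p (suc N) {λs} dec f g with p N in eq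
encode-unique p (suc N) {λs} dec f g | false = encode-unique p N dec
    (λ x∈ → ≤∧≢⇒< (s≤s⁻¹ (proj₁ (f x∈))) (λ { refl → subst T eq (proj₂ (f x∈)) }) , proj₂ (f x∈))
                (λ x<N → g (m<n⇒m<1+n x<N))
encode-unique p (suc N) {[]} dec f g | true = contradiction (g {N} ≤-refl (subst T (sym eq) tt)) λ ()
encode-unique p (suc N) {a ∷ μs} (a> ∷ dec) f g | true = cong₂ _∷_ a≡ μs≡
  where
  bound : ∀ {x} → x ∈ beta μs → x < a + length μs
  bound x∈ = <-trans (n<1+n _) (beta-bound a> x∈)
  N≡head : N ∈ beta (a ∷ μs) → N ≡ a + length μs
  N≡head (here e) = e
  N≡head (there N∈′) = contradiction (bound N∈′) (≤⇒≯ (s≤s⁻¹ (proj₁ (f (here refl)))))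
  N≡ = N≡head (g ≤-refl (subst T (sym eq) tt))
  μs≡ : μs ≡ encode p N
  μs≡ = encode-unique p N dec (λ x∈ → subst (_ <_) (sym N≡) (bound x∈) , proj₂ (f (there x∈)))
    (λ {x} x<N px → beta-tail a> ≤-refl (subst (x <_) N≡ x<N) (g (m<n⇒m<1+n x<N) px))
  a≡ : a ≡ N ∸ length (encode p N)
  a≡ = trans (sym (m+n∸n≡m a (length μs))) (cong₂ _∸_ (sym N≡) (cong length μs≡))

encode-length : ∀ p N → length (encode p N) ≡ sumBelow (λ x → if p x then 1 else 0) N
encode-length p zero = refl
encode-length p (suc N) with p N
... | true = cong suc (encode-length p N)
... | false = encode-length p N

-- A beta element exceeds its part by the number of later parts, and for l parts these excesses 0,
-- ..., l - 1 add up to `tri l`.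
encode-size : ∀ p N → sum (encode p N) + tri (length (encode p N)) ≡ sumBelow (λ x → if p x then x else 0) N
encode-size p zero = refl
encode-size p (suc N) with p N
... | false = encode-size p N
... | true = trans (lemma (N ∸ length (encode p N)) _ _ _)
    (cong₂ _+_ (m∸n+n≡m (encode-length≤ p N)) (encode-size p N))
  where
  lemma : ∀ a s l t → a + s + (l + t) ≡ a + l + (s + t)
  lemma = solve-∀

-- Sums over beads, arranged by columns.

sumBelow-cong : ∀ {f g} N → (∀ {x} → x < N → f x ≡ g x) → sumBelow f N ≡ sumBelow g N
sumBelow-cong zero _ = refl
sumBelow-cong (suc N) e = cong₂ _+_ (e ≤-refl) (sumBelow-cong N (e ∘ m<n⇒m<1+n))

sumBelow-split : ∀ f a b → sumBelow f (a + b) ≡ sumBelow (λ r → f (r + b)) a + sumBelow f b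
sumBelow-split f zero b = refl
sumBelow-split f (suc a) b = trans (cong (f (a + b) +_) (sumBelow-split f a b)) (sym (+-assoc (f (a + b)) _ _))

sumBelow-+ : ∀ f g N → sumBelow (λ x → f x + g x) N ≡ sumBelow f N + sumBelow g N
sumBelow-+ f g zero = refl
sumBelow-+ f g (suc N) rewrite sumBelow-+ f g N = lemma (f N) (g N) (sumBelow f N) (sumBelow g N)
  where
  lemma : ∀ a b c d → a + b + (c + d) ≡ a + c + (b + d)
  lemma = solve-∀

sumBelow-grid : ∀ f n d → sumBelow f (d * n) ≡ sumBelow (λ r → sumBelow (λ k → f (r + k * n)) d) n
sumBelow-grid f n zero = sym (sumBelow-* 0 (λ _ → 0) n)
sumBelow-grid f n (suc d) = trans (sumBelow-split f n (d * n))
  (trans (cong (sumBelow (λ r → f (r + d * n)) n +_) (sumBelow-grid f n d)) (sym (sumBelow-+ _ _ n)))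

sumBelow-truncate : ∀ f {c d} → c ≤ d → sumBelow (λ k → if k <ᵇ c then f k else 0) d ≡ sumBelow f c
sumBelow-truncate f {c} {d} c≤d with m≤n⇒m<n∨m≡n c≤d
... | inj₂ refl = sumBelow-cong c (λ {x} x<c → cong (λ b → if b then f x else 0) (<ᵇ-true x<c))
sumBelow-truncate f {c} {suc d} c≤d | inj₁ c<d
  rewrite <ᵇ-false (s≤s⁻¹ c<d) = sumBelow-truncate f (s≤s⁻¹ c<d)

sumBelow-column : ∀ r n c → sumBelow (λ k → r + k * n) c ≡ r * c + n * tri c
sumBelow-column r n zero = sym (cong₂ _+_ (*-zeroʳ r) (*-zeroʳ n))
sumBelow-column r n (suc c) rewrite sumBelow-column r n c = lemma r n c (tri c)
  where
  lemma : ∀ r n c t → r + c * n + (r * c + n * t) ≡ r * (1 + c) + n * (c + t)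
  lemma = solve-∀

sumBelow-1 : ∀ c → sumBelow (λ _ → 1) c ≡ c
sumBelow-1 zero = refl
sumBelow-1 (suc c) = cong suc (sumBelow-1 c)

-- Indexing from the end of the list.
at : List ℕ → ℕ → ℕ
at [] r = 0
at (v ∷ s) r with r ≟ length s
... | yes _ = v
... | no _ = at s r

at-here : ∀ v s → at (v ∷ s) (length s) ≡ v
at-here v s with length s ≟ length s
... | yes _ = refl
... | no l≢l = contradiction refl l≢l

at-there : ∀ {v s r} → r ≢ length s → at (v ∷ s) r ≡ at s r
at-there {v} {s} {r} r≢l with r ≟ length s
... | yes r≡l = contradiction r≡l r≢l
... | no _ = refl

at-beyond : ∀ s {r} → length s ≤ r → at s r ≡ 0
at-beyond [] _ = refl
at-beyond (v ∷ s) l<r = trans (at-there (<⇒≢ l<r ∘ sym)) (at-beyond s (<⇒≤ l<r))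

at-injective : ∀ s s′ → length s ≡ length s′ → (∀ {r} → r < length s → at s r ≡ at s′ r) → s ≡ s′
at-injective [] [] _ _ = refl
at-injective (v ∷ s) (v′ ∷ s′) l e = cong₂ _∷_
  (trans (sym (at-here v s)) (trans (e ≤-refl) (trans (cong (at (v′ ∷ s′)) l′) (at-here v′ s′))))
  (at-injective s s′ l′ λ r< →
      trans (sym (at-there (<⇒≢ r<))) (trans (e (m<n⇒m<1+n r<)) (at-there (λ r≡ → <⇒≢ r< (trans r≡ (sym l′))))))
  where
  l′ = suc-injective l

sumBelow-at : ∀ (F : ℕ → ℕ → ℕ) (G : List ℕ → ℕ) → G [] ≡ 0 → (∀ v s → G (v ∷ s) ≡ F (length s) v + G s) →
  ∀ s → sumBelow (λ r → F r (at s r)) (length s) ≡ G s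
sumBelow-at F G G₀ G₊ [] = sym G₀
sumBelow-at F G G₀ G₊ (v ∷ s) = trans (cong₂ _+_ (cong (F (length s)) (at-here v s))
    (trans (sumBelow-cong (length s) (λ {r} r< → cong (F r) (at-there (<⇒≢ r<)))) (sumBelow-at F G G₀ G₊ s)))
  (sym (G₊ v s))

-- The bead at r + k n is present exactly when k is below the height of column r.
abacus : ∀ n .{{_ : NonZero n}} → List ℕ → ℕ → Bool
abacus n s x = x / n <ᵇ at s (x % n)

abacus-coordinates : ∀ n .{{_ : NonZero n}} s {r} k → r < n → abacus n s (r + k * n) ≡ (k <ᵇ at s r)
abacus-coordinates n s {r} k r<n = cong₂ (λ q i → q <ᵇ at s i)
  (trans (+-distrib-/-∣ʳ r (n∣m*n k)) (cong₂ _+_ (m<n⇒m/n≡0 r<n) (m*n/n≡m k n)))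
  (trans ([m+kn]%n≡m%n r k n) (m<n⇒m%n≡m r<n))

module _ (n : ℕ) .{{_ : NonZero n}} (d : ℕ) (s : List ℕ) (len : length s ≡ n) (at≤d : ∀ r → at s r ≤ d) where

  sumBelow-abacus : ∀ (f : ℕ → ℕ) → sumBelow (λ x → if abacus n s x then f x else 0) (d * n)
    ≡ sumBelow (λ r → sumBelow (λ k → f (r + k * n)) (at s r)) n
  sumBelow-abacus f = trans (sumBelow-grid _ n d) (sumBelow-cong n λ {r} r<n →
    trans (sumBelow-cong d λ {k} _ → cong (λ b → if b then f (r + k * n) else 0) (abacus-coordinates n s k r<n))
          (sumBelow-truncate (λ k → f (r + k * n)) (at≤d r)))

  abacus-length : length (encode (abacus n s) (d * n)) ≡ sum s
  abacus-length = trans (encode-length (abacus n s) (d * n)) (trans (sumBelow-abacus (λ _ → 1))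
    (trans (sumBelow-cong n (λ {r} _ → sumBelow-1 (at s r)))
      (trans (cong (sumBelow (at s)) (sym len)) (sumBelow-at (λ _ c → c) sum refl (λ _ _ → refl) s))))

  abacus-size : size (encode (abacus n s) (d * n)) + tri (sum s) ≡ weighted s + n * triSum s
  abacus-size = trans (cong (λ l → size (encode (abacus n s) (d * n)) + tri l) (sym abacus-length))
    (trans (encode-size (abacus n s) (d * n)) (trans (sumBelow-abacus (λ x → x))
    (trans (sumBelow-cong n (λ {r} _ → sumBelow-column r n (at s r)))
      (trans (cong (sumBelow (λ r → r * at s r + n * tri (at s r))) (sym len))
        (sumBelow-at (λ r c → r * c + n * tri c) (λ s → weighted s + n * triSum s) (*-zeroʳ n)
          (λ v s → lemma (length s * v) (weighted s) n (tri v) (triSum s)) s)))))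
    where
    lemma : ∀ a b n t u → a + b + n * (t + u) ≡ a + n * t + (b + n * u)
    lemma = solve-∀

-- Words and cores

-- The bounds range over all `r` because `at` is 0 beyond the word.
record Valid (d m : ℕ) (s : List ℕ) : Set where
  constructor valid
  field
    len : length s ≡ m
    at0 : at s 0 ≡ 0
    at≤d : ∀ r → at s r ≤ d
    sparse : ∀ r → at s r ≡ 0 ⊎ at s (suc r) ≡ 0
open Valid

-- `0 < m` keeps a nonzero `v` out of column 0.
∷-valid : ∀ {d m v s} → v ≤ d → v ≡ 0 ⊎ (0 < m × at s (pred m) ≡ 0) → Valid d m s → Valid d (suc m) (v ∷ s)
∷-valid {d} {_} {v} {s} v≤d top (valid refl at0 at≤d sparse) = valid refl (at0′ top) at≤d′ (sparse′ top)
  where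
  Top : Set
  Top = v ≡ 0 ⊎ (0 < length s × at s (pred (length s)) ≡ 0)
  at0′ : Top → at (v ∷ s) 0 ≡ 0
  at0′ top with 0 ≟ length s
  ... | no _ = at0
  at0′ (inj₁ v≡0) | yes _ = v≡0
  at0′ (inj₂ (0<l , _)) | yes e = contradiction e (<⇒≢ 0<l)
  at≤d′ : ∀ r → at (v ∷ s) r ≤ d
  at≤d′ r with r ≟ length s
  ... | yes _ = v≤d
  ... | no _ = at≤d r
  sparse′ : Top → ∀ r → at (v ∷ s) r ≡ 0 ⊎ at (v ∷ s) (suc r) ≡ 0
  sparse′ top r with r ≟ length s | suc r ≟ length s
  ... | yes r≡ | yes sr≡ = contradiction (trans r≡ (sym sr≡)) (<⇒≢ ≤-refl)
  ... | yes r≡ | no _ = inj₂ (at-beyond s (≤-trans (≤-reflexive (sym r≡)) (n≤1+n r)))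
  ... | no _ | no _ = sparse r
  sparse′ (inj₁ v≡0) r | no _ | yes _ = inj₂ v≡0
  sparse′ (inj₂ (_ , t)) r | no _ | yes e = inj₁ (subst (λ l → at s (pred l) ≡ 0) (sym e) t)

0∷-valid : ∀ {d m s} → Valid d m s → Valid d (suc m) (0 ∷ s)
0∷-valid = ∷-valid z≤n (inj₁ refl)

prepend-valid : ∀ {d m v s} → v < d → Valid d m s → Valid d (2 + m) (prepend v s)
prepend-valid {s = s} v<d ok@(valid refl _ _ _) = ∷-valid v<d (inj₂ (s≤s z≤n , at-here 0 s)) (0∷-valid ok)

words-valid : ∀ d m → All (Valid d m) (words d m)
words-valid d = All-words (Valid d) d nil (0∷-valid nil) 0∷-valid prepend-valid
  where
  nil : Valid d 0 []
  nil = valid refl refl (λ _ → z≤n) (λ _ → inj₁ refl)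

coreWords-valid : ∀ d .{{_ : NonZero d}} m → All (λ s → Valid d (2 + m) s × at s (suc m) < d) (coreWords d m)
coreWords-valid d@(suc e) m = All-extend e
  (λ {s} ok → 0∷-valid ok , ≤-<-trans (≤-reflexive (trans (cong (at (0 ∷ s)) (sym (len ok))) (at-here 0 s)))
      (s≤s z≤n))
  (λ {v} {s} v<e ok → prepend-valid (m<n⇒m<1+n v<e) ok
    , ≤-<-trans (≤-reflexive (trans (cong (at (prepend v s) ∘ suc) (sym (len ok))) (at-here (suc v) (0 ∷ s))))
        (s≤s v<e))
  (words-valid d (suc m)) (words-valid d m)

tabulateDown : (ℕ → ℕ) → ℕ → List ℕ
tabulateDown c zero = []
tabulateDown c (suc m) = c m ∷ tabulateDown c m

tabulateDown-length : ∀ c m → length (tabulateDown c m) ≡ m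
tabulateDown-length c zero = refl
tabulateDown-length c (suc m) = cong suc (tabulateDown-length c m)

at-tabulateDown : ∀ c {m r} → r < m → at (tabulateDown c m) r ≡ c r
at-tabulateDown c {suc m} {r} r<m with r ≟ length (tabulateDown c m)
... | yes e = cong c (sym (trans e (tabulateDown-length c m)))
... | no r≢ = at-tabulateDown c (≤∧≢⇒< (s≤s⁻¹ r<m) (λ e → r≢ (trans e (sym (tabulateDown-length c m)))))

module _ {c : ℕ → ℕ} (sparse : ∀ r → c r ≡ 0 ⊎ c (suc r) ≡ 0) where

  tabulateDown∈extend : ∀ {e m L L′} → c (suc m) ≤ e → tabulateDown c (suc m) ∈ L → tabulateDown c m ∈ L′ →
    tabulateDown c (2 + m) ∈ extend e L L′
  tabulateDown∈extend {e} {m} {L} {L′} c≤e t∈L t∈L′ with c (suc m) | sparse m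
  ... | zero | _ = ∈-++⁺ˡ (∈-map⁺ (0 ∷_) t∈L)
  ... | suc v | inj₁ cm≡0 rewrite cm≡0 =
    ∈-++⁺ʳ (map (0 ∷_) L) (∈-cartesianProductWith⁺ prepend (∈-downFrom⁺ c≤e) t∈L′)
  ... | suc v | inj₂ ()

  tabulateDown∈words : ∀ {d} → c 0 ≡ 0 → (∀ r → c r ≤ d) → ∀ m → tabulateDown c m ∈ words d m
  tabulateDown∈words c0 c≤d zero = here refl
  tabulateDown∈words c0 c≤d (suc zero) = here (cong (_∷ []) c0)
  tabulateDown∈words c0 c≤d (suc (suc m)) =
    tabulateDown∈extend (c≤d (suc m)) (tabulateDown∈words c0 c≤d (suc m)) (tabulateDown∈words c0 c≤d m)

extend-unique : ∀ e {L L′} → Unique L → Unique L′ → Unique (extend e L L′)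
extend-unique e {L} {L′} uL uL′ = Unique.++⁺ (Unique.map⁺ ∷-injectiveʳ uL)
  (Unique.cartesianProductWith⁺ prepend (λ { refl → refl , refl }) (Unique.downFrom⁺ e) uL′) disjoint
  where
  disjoint : ∀ {s} → ¬ (s ∈ map (0 ∷_) L × s ∈ cartesianProductWith prepend (downFrom e) L′)
  disjoint (s∈₁ , s∈₂) with ∈-map⁻ (0 ∷_) s∈₁ | ∈-cartesianProductWith⁻ prepend (downFrom e) L′ s∈₂
  ... | _ , _ , refl | _ , _ , _ , _ , ()

words-unique : ∀ d m → Unique (words d m)
words-unique d zero = [] ∷ []
words-unique d (suc zero) = [] ∷ []
words-unique d (suc (suc m)) = extend-unique d (words-unique d (suc m)) (words-unique d m)

Unique-map : ∀ {A B : Set} (f : A → B) {xs} → (∀ {x y} → x ∈ xs → y ∈ xs → f x ≡ f y → x ≡ y) → Unique xs →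
    Unique (map f xs)
Unique-map f inj [] = []
Unique-map f {x ∷ xs} inj (x∉ ∷ u) = All.tabulate fresh ∷ Unique-map f (λ x∈ y∈ → inj (there x∈) (there y∈)) u
  where
  fresh : ∀ {z} → z ∈ map f xs → f x ≢ z
  fresh z∈ fx≡z with ∈-map⁻ f z∈
  ... | y , y∈ , refl = All.lookup x∉ y∈ (inj (here refl) (there y∈) fx≡z)

grid-bound : ∀ {n d r k} → r < n → k < d → r + k * n < d * n
grid-bound {n} {d} {r} {k} r<n k<d = ≤-trans (+-monoˡ-≤ (k * n) r<n) (*-monoˡ-≤ n k<d)

-- From words to core partitions.

partition : ℕ → ℕ → List ℕ → List ℕ
partition d m s = encode (abacus (2 + m) s) (d * (2 + m))

module _ (d m : ℕ) .{{_ : NonZero d}} where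
  private
    n = 2 + m
    N = d * n

  -- The highest bead of column `r` in the first abacus is a beta element, hence also a bead of the
  -- second.
  partition-at≤ : ∀ s s′ → Valid d n s → partition d m s ≡ partition d m s′ → ∀ {r} → r < n → at s r ≤ at s′ r
  partition-at≤ s s′ ok eq {r} r<n with at s r in e
  ... | zero = z≤n
  ... | suc k = <ᵇ⇒< k _ (subst T (abacus-coordinates n s′ k r<n) (proj₂ (∈-encode⁻ (abacus n s′) N
          (subst (λ μ → r + k * n ∈ beta μ) eq
              (∈-encode⁺ (abacus n s) N (grid-bound r<n (≤-trans (≤-reflexive (sym e)) (at≤d ok r)))
            (subst T (sym (abacus-coordinates n s k r<n)) (<⇒<ᵇ (≤-reflexive (sym e)))))))))

  partition-injective : ∀ s s′ → Valid d n s → Valid d n s′ → partition d m s ≡ partition d m s′ → s ≡ s′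
  partition-injective s s′ ok ok′ eq = at-injective s s′ (trans (len ok) (sym (len ok′)))
    λ {r} r< → let r<n = subst (r <_) (len ok) r< in
      ≤-antisym (partition-at≤ s s′ ok eq r<n) (partition-at≤ s′ s ok′ (sym eq) r<n)

  module _ {s} (ok : Valid d n s) (top : at s (suc m) < d) where
    private
      p = abacus n s

    abacus-0 : ¬ T (p 0)
    abacus-0 p0 with at s 0 | at0 ok
    ... | _ | refl = p0

    coordinates : ∀ x → x ≡ x % n + x / n * n
    coordinates x = m≡m%n+[m/n]*n x n

    abacus-sparse : ∀ x → T (p x) → ¬ T (p (suc x))
    abacus-sparse x px psx with suc (x % n) <? n | sparse ok (x % n)
    ... | yes r<n | inj₁ z = contradiction (<ᵇ⇒< (x / n) _ px) (λ lt → n≮0 (subst (x / n <_) z lt))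
    ... | yes r<n | inj₂ z = n≮0 (subst (x / n <_) z (<ᵇ⇒< (x / n) _ (subst T
            (trans (cong p (cong suc (coordinates x))) (abacus-coordinates n s (x / n) r<n)) psx)))
    -- Wrap-around: the number after a bead of the last column lies in column 0, which is empty.
    ... | no r≮n | _ = n≮0 (subst (suc (x / n) <_) (at0 ok) (<ᵇ⇒< (suc (x / n)) _ (subst T
            (trans (cong p (trans (cong suc (coordinates x)) (cong (_+ x / n * n) r≡)))
                (abacus-coordinates n s {0} (suc (x / n)) (s≤s z≤n))) psx)))
      where
      r≡ : suc (x % n) ≡ n
      r≡ = ≤-antisym (m%n<n x n) (≮⇒≥ r≮n)

    -- Heights at most d give x < dn. The value dn - 1 sits in row d - 1 of the last column and is
    -- excluded by `top`.
    abacus-bound : ∀ {x} → T (p x) → suc x < N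
    abacus-bound {x} px with suc (x % n) <? n
    ... | yes r<n = subst (_< N) (cong suc (sym (coordinates x)))
        (grid-bound r<n (<-≤-trans (<ᵇ⇒< (x / n) _ px) (at≤d ok (x % n))))
    ... | no r≮n = subst (_< N) (cong suc (sym (coordinates x)))
          (subst (λ r → r + x / n * n < N) (sym r≡)
              (*-monoˡ-< n (≤-<-trans (<ᵇ⇒< (x / n) _
              (subst (λ r → T (x / n <ᵇ at s r)) (suc-injective r≡) px)) top)))
      where
      r≡ : suc (x % n) ≡ n
      r≡ = ≤-antisym (m%n<n x n) (≮⇒≥ r≮n)

    partition-InC : InC n d (partition d m s)
    partition-InC = (AllPairs⇒Linked dec , encode-positive p abacus-0 abacus-sparse N)
      , closed⇒core dec closed₁ , closed⇒core dec closed₂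
      where
      dec : Decreasing (partition d m s)
      dec = encode-decreasing p abacus-0 abacus-sparse N
      closed₁ : Closed n (beta (partition d m s))
      closed₁ {x} h x∈ 0<h (divides j refl) h≤x with ∈-encode⁻ p N x∈
      ... | x<N , px = ∈-encode⁺ p N (≤-<-trans (m∸n≤m x h) x<N)
            (<⇒<ᵇ (≤-<-trans (≤-trans (≤-reflexive ([m∸n*o]/o≡m/o∸n x j n)) (m∸n≤m (x / n) j))
              (<-≤-trans (<ᵇ⇒< (x / n) _ px) (≤-reflexive (cong (at s) (sym (m*n≤o⇒[o∸m*n]%n≡o%n j h≤x)))))))
      closed₂ : Closed (d * n ∸ 1) (beta (partition d m s))
      closed₂ {x} h@(suc _) x∈ 0<h t∣h h≤x =
        contradiction (∸-monoˡ-≤ 1 (abacus-bound (proj₂ (∈-encode⁻ p N x∈)))) (≤⇒≯ (≤-trans (∣⇒≤ t∣h) h≤x))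

-- From core partitions to words.

-- One more than the largest `k < d` with `q k`, or 0 if there is none; for a downward closed `q`
-- this is the height of a column.
threshold : (ℕ → Bool) → ℕ → ℕ
threshold q zero = 0
threshold q (suc d) = if q d then suc d else threshold q d

threshold≤ : ∀ q d → threshold q d ≤ d
threshold≤ q zero = z≤n
threshold≤ q (suc d) with q d
... | true = ≤-refl
... | false = m≤n⇒m≤1+n (threshold≤ q d)

threshold⁺ : ∀ q {k d} → k < d → T (q k) → k < threshold q d
threshold⁺ q {k} {suc d} k<d qk with k ≟ d | q d in eq
... | _ | true = k<d
... | yes refl | false = contradiction (subst T eq qk) λ ()
... | no k≢d | false = threshold⁺ q (≤∧≢⇒< (s≤s⁻¹ k<d) k≢d) qk

threshold⁻ : ∀ q → (∀ k → T (q (suc k)) → T (q k)) → ∀ {k} d → k < threshold q d → T (q k)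
threshold⁻ q down {k} (suc d) k< with q d in eq
... | false = threshold⁻ q down d k<
... | true = descend (≤⇒≤′ (s≤s⁻¹ k<)) (subst T (sym eq) tt)
  where
  descend : ∀ {j} → k ≤′ j → T (q j) → T (q k)
  descend ≤′-refl qj = qj
  descend (≤′-step k≤j) qj = descend k≤j (down _ qj)

beta-positive : ∀ {λs} → All (0 <_) λs → 0 ∉ beta λs
beta-positive (0<a ∷ pos) (here e) = <⇒≢ (≤-trans 0<a (m≤m+n _ _)) e
beta-positive (_ ∷ pos) (there 0∈) = beta-positive pos 0∈

beta-sparse : ∀ {λs} → Decreasing λs → ∀ {x} → x ∈ beta λs → suc x ∉ beta λs
beta-sparse (a> ∷ dec) (here refl) (here e) = <⇒≢ (n<1+n _) (sym e)
beta-sparse (a> ∷ dec) (here refl) (there sx∈) = <⇒≱ (beta-bound a> sx∈) (m≤n⇒m≤1+n (n≤1+n _))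
beta-sparse (a> ∷ dec) (there x∈) (here e) = <⇒≢ (beta-bound a> x∈) e
beta-sparse (a> ∷ dec) (there x∈) (there sx∈) = beta-sparse dec x∈ sx∈

module _ (d m : ℕ) .{{_ : NonZero d}} {λs : List ℕ} (inC : InC (2 + m) d λs) where
  private
    n = 2 + m
    N = d * n
    B = beta λs
    dec : Decreasing λs
    dec = Linked⇒AllPairs (λ b<a c<b → <-trans c<b b<a) (proj₁ (proj₁ inC))
    0∉B : 0 ∉ B
    0∉B = beta-positive (proj₂ (proj₁ inC))
    closed₁ : Closed n B
    closed₁ = core⇒closed dec (proj₁ (proj₂ inC))
    closed₂ : Closed (N ∸ 1) B
    closed₂ = core⇒closed dec (proj₂ (proj₂ inC))
    2≤N : 2 ≤ N
    2≤N = ≤-trans (s≤s (s≤s z≤n)) (m≤n*m n d)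

  InC-bound : ∀ {x} → x ∈ B → suc x < N
  InC-bound {x} x∈ with suc x <? N
  ... | yes lt = lt
  ... | no ≮ with m≤n⇒m<n∨m≡n (≮⇒≥ ≮)
  ...   | inj₂ N≡ = contradiction (subst (_∈ B) (trans (cong (λ z → x ∸ (z ∸ 1)) N≡) (n∸n≡0 x))
            (closed₂ (N ∸ 1) x∈ (m<n⇒0<n∸m 2≤N) ∣-refl (≤-reflexive (cong (_∸ 1) N≡)))) 0∉B
  ...   | inj₁ N<sx = contradiction
      (subst (_∈ B) shift (closed₂ (N ∸ 1) x∈ (m<n⇒0<n∸m 2≤N) ∣-refl (≤-trans (m∸n≤m N 1) N≤x)))
            (beta-sparse dec (closed₁ N x∈ (≤-trans (s≤s z≤n) 2≤N) (n∣m*n d) N≤x))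
    where
    N≤x : N ≤ x
    N≤x = s≤s⁻¹ N<sx
    shift : x ∸ (N ∸ 1) ≡ suc (x ∸ N)
    shift = trans (cong (λ z → suc x ∸ z) (m+[n∸m]≡n {1} {N} (≤-trans (s≤s z≤n) 2≤N))) (+-∸-assoc 1 N≤x)

  private
    q : ℕ → ℕ → Bool
    q r k = ⌊ r + k * n ∈? B ⌋
    q-down : ∀ r k → T (q r (suc k)) → T (q r k)
    q-down r k qk = fromWitness
        (subst (_∈ B) eq (closed₁ n (toWitness qk) (s≤s z≤n) ∣-refl (≤-trans (m≤m+n n (k * n)) (m≤n+m _ r))))
      where
      eq : r + (n + k * n) ∸ n ≡ r + k * n
      eq = trans (+-∸-assoc r (m≤m+n n (k * n))) (cong (r +_) (m+n∸m≡n n (k * n)))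
    c : ℕ → ℕ
    c r = threshold (q r) d
    c⁻ : ∀ {r k} → k < c r → r + k * n ∈ B
    c⁻ {r} k<c = toWitness (threshold⁻ (q r) (q-down r) d k<c)
    c-zero : ∀ r → r ∉ B → c r ≡ 0
    c-zero r r∉ with c r in eq
    ... | zero = refl
    ... | suc _ = contradiction (subst (_∈ B) (+-identityʳ r) (c⁻ (≤-trans (s≤s z≤n) (≤-reflexive (sym eq))))) r∉
    -- A nonempty column contains its lowest bead `r`, so adjacency of columns is decided in row 0.
    c-sparse : ∀ r → c r ≡ 0 ⊎ c (suc r) ≡ 0
    c-sparse r with r ∈? B
    ... | no r∉ = inj₁ (c-zero r r∉)
    ... | yes r∈ = inj₂ (c-zero (suc r) (beta-sparse dec r∈))
    c≤d : ∀ r → c r ≤ d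
    c≤d r = threshold≤ (q r) d
    c-top : c (suc m) ≤ pred d
    -- A bead in row `pred d` of the last column would be the number dn - 1, too large for
    -- `InC-bound`.
    c-top = ≮⇒≥ λ lt → <-irrefl (cong (_* n) (suc-pred d)) (InC-bound (c⁻ lt))
    word = tabulateDown c n
    p = abacus n word

  InC-word∈coreWords : word ∈ coreWords d m
  InC-word∈coreWords = tabulateDown∈extend c-sparse c-top
    (tabulateDown∈words c-sparse (c-zero 0 0∉B) c≤d (suc m)) (tabulateDown∈words c-sparse (c-zero 0 0∉B) c≤d m)

  InC-decode : λs ≡ partition d m word
  InC-decode = encode-unique p N dec
    (λ {x} x∈ → let x<N = <-trans (n<1+n x) (InC-bound x∈) in
      x<N , <⇒<ᵇ (subst (x / n <_) (sym (at≡ x))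
          (threshold⁺ (q (x % n)) (m<n*o⇒m/o<n {x} {d} {n} x<N) (fromWitness (subst (_∈ B) (m≡m%n+[m/n]*n x n) x∈)))))
    (λ {x} x<N px → subst (_∈ B) (sym (m≡m%n+[m/n]*n x n)) (c⁻ (subst (x / n <_) (at≡ x) (<ᵇ⇒< (x / n) _ px))))
    where
    at≡ : ∀ x → at word (x % n) ≡ c (x % n)
    at≡ x = at-tabulateDown c (m%n<n x n)

-- The list of cores and its total size.

cores : ℕ → ℕ → List (List ℕ)
cores d m = map (partition d m) (coreWords d m)

cores-unique : ∀ d .{{_ : NonZero d}} m → Unique (cores d m)
cores-unique d m = Unique-map _
  (λ {x} {y} x∈ y∈ → partition-injective d m x y (proj₁ (All.lookup (coreWords-valid d m) x∈))
      (proj₁ (All.lookup (coreWords-valid d m) y∈)))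
  (extend-unique (pred d) (words-unique d (suc m)) (words-unique d m))

∈-cores : ∀ d .{{_ : NonZero d}} m λs → (λs ∈ cores d m) ⇔ InC (2 + m) d λs
∈-cores d m λs = mk⇔ to from
  where
  to : λs ∈ cores d m → InC (2 + m) d λs
  to λs∈ with ∈-map⁻ _ λs∈
  ... | s , s∈ , refl with All.lookup (coreWords-valid d m) s∈
  ...   | ok , top = partition-InC d m ok top
  from : InC (2 + m) d λs → λs ∈ cores d m
  from inC = subst (_∈ cores d m) (sym (InC-decode d m inC)) (∈-map⁺ _ (InC-word∈coreWords d m inC))

cores-size : ∀ d .{{_ : NonZero d}} m → total size (cores d m) + total (tri ∘ sum) (coreWords d m)
  ≡ total weighted (coreWords d m) + (2 + m) * total triSum (coreWords d m)
cores-size d m = trans (cong (_+ total (tri ∘ sum) (coreWords d m)) (total-map size (partition d m) (coreWords d m)))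
  (go (coreWords-valid d m))
  where
  go : ∀ {L} → All (λ s → Valid d (2 + m) s × at s (suc m) < d) L →
    total (size ∘ partition d m) L + total (tri ∘ sum) L ≡ total weighted L + (2 + m) * total triSum L
  go [] = sym (*-zeroʳ m)
  go {s ∷ L} ((ok , _) ∷ oks) = trans
      (lemma₁ (size (partition d m s)) (tri (sum s)) (total (size ∘ partition d m) L) (total (tri ∘ sum) L))
    (trans (cong₂ _+_ (abacus-size (2 + m) d s (len ok) (at≤d ok)) (go oks))
      (lemma₂ m (weighted s) (triSum s) (total weighted L) (total triSum L)))
    where
    lemma₁ : ∀ a b c d → a + c + (b + d) ≡ a + b + (c + d)
    lemma₁ = solve-∀
    lemma₂ : ∀ m a b c d → a + (2 + m) * b + (c + (2 + m) * d) ≡ a + c + (2 + m) * (b + d)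
    lemma₂ = solve-∀

open import Data.Integer using (ℤ; +_; -_) renaming (_+_ to _+ℤ_; _*_ to _*ℤ_; _-_ to _-ℤ_; _^_ to _^ℤ_)
open import Data.Rational using (ℚ) renaming (_+_ to _+ℚ_; _*_ to _*ℚ_; _-_ to _-ℚ_)

theorem1p11 : (d n : ℕ) → 1 ≤ d → 2 ≤ n →
  let D = + d
      N = + n
      c : ℕ → ℤ
      c k = + k
  in
  Σ (List (List ℕ)) (λ L →
    Unique L
    × ((λs : List ℕ) → (λs ∈ L) ⇔ InC n d λs)
    × (c (sum (map size L)) // 1
       ≡ (c (M d n) // 1) *ℚ
           ((((D ^ℤ 2 -ℤ c 1) *ℤ (c 5 *ℤ D ^ℤ 2 +ℤ D -ℤ c 1) *ℤ N ^ℤ 2) // (24 * d * (4 * d + 1)))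
            -ℚ (((D +ℤ c 1) *ℤ (c 8 *ℤ D ^ℤ 4 +ℤ c 27 *ℤ D ^ℤ 3 +ℤ c 2 *ℤ D ^ℤ 2 -ℤ c 1) *ℤ N) // (24 * d * ((4 * d + 1) * (4 * d + 1))))
            +ℚ ((D ^ℤ 2 -ℤ c 1) // (12 * d)))
         +ℚ (c (M d (n ∸ 1)) // 1) *ℚ
           ((((D +ℤ c 1) *ℤ (- (D ^ℤ 3) +ℤ c 7 *ℤ D ^ℤ 2 +ℤ D -ℤ c 1) *ℤ N ^ℤ 2) // (24 * d * (4 * d + 1)))
            -ℚ (((D +ℤ c 1) *ℤ (c 6 *ℤ D ^ℤ 4 -ℤ c 19 *ℤ D ^ℤ 3 -ℤ c 7 *ℤ D ^ℤ 2 +ℤ D +ℤ c 1) *ℤ N) // (24 * d * ((4 * d + 1) * (4 * d + 1))))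
            -ℚ (((D +ℤ c 1) *ℤ (D ^ℤ 4 +ℤ c 20 *ℤ D ^ℤ 3 -ℤ c 6 *ℤ D ^ℤ 2 -ℤ c 8 *ℤ D -ℤ c 1)) // (12 * d * ((4 * d + 1) * (4 * d + 1)))))))
theorem1p11 (suc _) (suc zero) _ (s≤s ())
theorem1p11 (suc e) (suc (suc m)) _ _ = cores d m , cores-unique d m , ∈-cores d m ,
  -- `M d (2 + m)` unfolds to `M d (suc m) + d * M d m`, the form in which `size-formula` delivers
  -- the first coefficient.
  Formula.rational-formula (+ total size (cores d m)) (+ M d (2 + m)) (+ M d (suc m)) d (2 + m)
    (Formula.size-formula (total size (cores d m)) (total (tri ∘ sum) (coreWords d m))
        (total weighted (coreWords d m)) (total triSum (coreWords d m))
      (tetra d) (tetra e) (triangle d) (triangle e) (conv₂ d (suc m)) (conv₂ d m) (conv₃ d (suc m)) (conv₃ d m)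
          (M d (suc m)) (M d m) e m
      (2*triangle d) (2*triangle e) (6*tetra d) (6*tetra e) (cores-size d m)
      -- The last column has height at most e = d - 1, while the columns below it have the bound d;
      -- hence the mixture of `e` and `d`.
      (trans (triOfSum-extend d e m) (cong₂ _+_ (total-triOfSum d (suc m))
        (cong₂ (λ a t → M d m * tetra e + triangle e * a + e * t) (total-sum d m) (total-triOfSum d m))))
      (trans (triSum-extend d e m)
          (cong₂ (λ a b → a + (M d m * tetra e + e * b)) (total-triSum d (suc m)) (total-triSum d m)))
      (trans (cong (λ a → 2 * a) (weighted-extend d e m))
          (trans (lemma (total weighted (words d (suc m))) (M d m * (suc m * triangle e)) e
          (total weighted (words d m)))
        (cong₂ (λ a b → a + (2 * (M d m * (suc m * triangle e)) + e * b)) (total-weighted d (suc m))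
            (total-weighted d m))))
      (conv₂-M d m) (conv₂-closed d m) (conv₃-closed d m) (conv₃-conv₂ d m))
  where
  d = suc e
  lemma : ∀ a b e c → 2 * (a + (b + e * c)) ≡ 2 * a + (2 * b + e * (2 * c))
  lemma = solve-∀
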